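{- The size-Ramsey number of the $n\times n$ square grid satisfies $\hat r(G_{n,n})\leq n^{3+o(1)}$ as $n\to\infty$; that is, for every $\varepsilon>0$ there is $n_0$ such that $\hat r(G_{n,n})\leq n^{3+\varepsilon}$ for all $n\geq n_0$.
   Context: For graphs $F$ and $G$, write $G\longrightarrow F$ if every $2$-colouring of the edges of $G$ yields a monochromatic copy of $F$ (as a not necessarily induced subgraph). The size-Ramsey number of $F$ is $\hat r(F)=\min\{e(G)\colon G\longrightarrow F\}$, where $e(G)$ is the number of edges of $G$. The grid graph $G_{s,t}$ has vertex set $[s]\times[t]$, where $[k]=\{1,\dots,k\}$, and $uv$ is an edge if and only if $u$ and $v$ differ in exactly one coordinate, by exactly one. -}

module Defs where

open import Data.Bool.Base using (Bool)
open import Data.Fin.Base using (Fin; toℕ)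
open import Data.Fin.Properties as Fin using (*↔×)
open import Data.Integer.Base using (∣_∣)
open import Data.List.Base using (List; length; filter; allFin; cartesianProduct)
open import Data.Nat.Base as ℕ using (ℕ; _≤_; _^_; ∣_-_∣)
open import Data.Nat.Properties as ℕ using (∣-∣-comm; ∣n-n∣≡0)
open import Data.Product.Base using (_×_; _,_; proj₁; proj₂; Σ-syntax; ∃-syntax)
open import Data.Rational.Unnormalised.Base using (ℚᵘ; ↥_; ↧ₙ_)
open import Data.Sum.Base using (_⊎_; inj₁; inj₂)
open import Function.Base using (_∘_)
open import Function.Bundles using (_↔_; module Inverse)
open import Function.Construct.Symmetry using (↔-sym)
open import Function.Definitions using (Injective)
open import Level using (0ℓ)
open import Relation.Binary.Core using (Rel)
open import Relation.Binary.Definitions using (Symmetric; Irreflexive; Decidable)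
open import Relation.Binary.PropositionalEquality using (_≡_; refl; sym; trans)
open import Relation.Nullary.Decidable using (_×-dec_; _⊎-dec_)

-- Finite simple graphs. Adjacency need not be proof-irrelevant: nothing below
-- depends on which proof of u ∼ v is used.
record Graph : Set₁ where
  infix 4 _∼_ _∼?_
  field
    Vertex   : Set
    order    : ℕ
    vertices : Vertex ↔ Fin order
    _∼_      : Rel Vertex 0ℓ
    _∼?_     : Decidable _∼_
    ∼-sym    : Symmetric _∼_
    ∼-irrefl : Irreflexive _≡_ _∼_

  vertex : Fin order → Vertex
  vertex = Inverse.from vertices

  -- Each edge is listed once, with its endpoints in increasing order.
  edges : List (Fin order × Fin order)
  edges = filter (λ (i , j) → (i Fin.<? j) ×-dec (vertex i ∼? vertex j))
                 (cartesianProduct (allFin order) (allFin order))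

  e : ℕ
  e = length edges

-- Taking arbitrary p and q in colour-sym makes the colour depend only on the
-- unordered pair {u , v}.
record Colouring (G : Graph) : Set where
  open Graph G
  field
    colour     : ∀ {u v} → u ∼ v → Bool
    colour-sym : ∀ {u v} (p : u ∼ v) (q : v ∼ u) → colour p ≡ colour q

record Copy (F G : Graph) : Set where
  private
    module F = Graph F
    module G = Graph G
  field
    embed     : F.Vertex → G.Vertex
    injective : Injective _≡_ _≡_ embed
    edge      : ∀ {u v} → u F.∼ v → embed u G.∼ embed v

Monochromatic : ∀ {F G} → Colouring G → Copy F G → Set
Monochromatic {F} χ φ =
  ∃[ c ] (∀ {u v} (p : u ∼ v) → colour (edge p) ≡ c)
  where
  open Graph F using (_∼_)
  open Colouring χ
  open Copy φ

infix 4 _⟶_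
_⟶_ : Graph → Graph → Set
G ⟶ F = (χ : Colouring G) → Σ[ φ ∈ Copy F G ] Monochromatic χ φ

-- r is the minimum of e(G) over all G with G ⟶ F.
IsSizeRamseyNumber : Graph → ℕ → Set₁
IsSizeRamseyNumber F r =
  (Σ[ G ∈ Graph ] (G ⟶ F) × Graph.e G ≡ r) ×
  ((G : Graph) → G ⟶ F → r ≤ Graph.e G)

-- Coordinates are 0, …, k - 1 rather than 1, …, k.
grid : ℕ → ℕ → Graph
grid s t = record
  { Vertex   = Fin s × Fin t
  ; order    = s ℕ.* t
  ; vertices = ↔-sym *↔×
  ; _∼_      = _∼_
  ; _∼?_     = λ (a , b) (c , d) →
      ((a Fin.≟ c) ×-dec (∣ toℕ b - toℕ d ∣ ℕ.≟ 1)) ⊎-dec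
      ((∣ toℕ a - toℕ c ∣ ℕ.≟ 1) ×-dec (b Fin.≟ d))
  ; ∼-sym    = ∼-sym
  ; ∼-irrefl = ∼-irrefl
  }
  where
  _∼_ : Rel (Fin s × Fin t) 0ℓ
  (a , b) ∼ (c , d) =
    (a ≡ c × ∣ toℕ b - toℕ d ∣ ≡ 1) ⊎ (∣ toℕ a - toℕ c ∣ ≡ 1 × b ≡ d)

  dist-sym : ∀ {k} (i j : Fin k) → ∣ toℕ i - toℕ j ∣ ≡ 1 → ∣ toℕ j - toℕ i ∣ ≡ 1
  dist-sym i j = trans (∣-∣-comm (toℕ j) (toℕ i))

  ∼-sym : Symmetric _∼_
  ∼-sym {a , b} {c , d} (inj₁ (p , q)) = inj₁ (sym p , dist-sym b d q)
  ∼-sym {a , b} {c , d} (inj₂ (p , q)) = inj₂ (dist-sym a c p , sym q)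

  ∼-irrefl : Irreflexive _≡_ _∼_
  ∼-irrefl {a , b} refl (inj₁ (_ , q)) with () ← trans (sym (∣n-n∣≡0 (toℕ b))) q
  ∼-irrefl {a , b} refl (inj₂ (p , _)) with () ← trans (sym (∣n-n∣≡0 (toℕ a))) p

-- r ≤ n ^ (p / q) for a non-negative exponent, with both sides raised to the
-- power q; for negative exponents the definition is meaningless.
infix 4 _≤_^ℚ_
_≤_^ℚ_ : ℕ → ℕ → ℚᵘ → Set
r ≤ n ^ℚ α = r ^ ↧ₙ α ≤ n ^ ∣ ↥ α ∣

{-# OPTIONS --safe #-}
module Submission where

-- Let H be a graph with O(n) vertices and edges in which any two sets of 2n - 1 vertices
-- are joined by an edge. The host is the blow-up of H in which every vertex becomes a
-- cluster of n^(1+o(1)) vertices, so it has n^(3+o(1)) edges. The grid is embedded diagonal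
-- by diagonal: it suffices to find a path of 2n - 1 clusters with subsets U₁, U₂, … such
-- that any two vertices of Uₖ₊₁ have at least n common neighbours of one colour in Uₖ.
-- A depth-first search extends such a path in red by dependent random choice as long as the
-- red density towards a new cluster is not small. If the red path stays short, the search
-- leaves many exhausted and many unvisited clusters with almost only blue edges between
-- adjacent ones; H contains a long path alternating between them, found by a second search,
-- and typical vertices along it have many common blue neighbours.
-- The minimum defining the size-Ramsey number is attained because, without isolated
-- vertices, only finitely many graphs compete with the host.

open import Data.Bool.Base using (Bool; true; false; not; _∧_; _∨_; T)
open import Data.Bool.ListAction using (any)
import Data.Bool.Properties as Bool
open import Data.Empty using (⊥; ⊥-elim)
open import Data.Fin.Base as Fin using (Fin; toℕ; fromℕ<; opposite)
import Data.Fin.Properties as Fin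
open import Data.Integer.Base as ℤ using (-[1+_])
import Data.Integer.Properties as ℤ
open import Data.List.Base as List
  using (List; []; _∷_; [_]; _++_; map; filter; filterᵇ; length; take; allFin; cartesianProduct; cartesianProductWith)
import Data.List.Properties as List
open import Data.List.Membership.Propositional using (_∈_; _∉_; find)
open import Data.List.Membership.Propositional.Properties
open import Data.List.Relation.Binary.Permutation.Propositional
  using (_↭_; ↭-refl; ↭-sym; ↭-trans; prep; ↭⇒↭ₛ)
import Data.List.Relation.Binary.Permutation.Propositional.Properties as ↭
import Data.List.Relation.Binary.Permutation.Setoid.Properties as ↭ₛ
open import Data.List.Relation.Binary.Subset.Propositional using (_⊆_)
open import Data.List.Relation.Unary.All as All using (All; []; _∷_)
import Data.List.Relation.Unary.All.Properties as All
open import Data.List.Relation.Unary.AllPairs as AllPairs using (AllPairs; []; _∷_)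
import Data.List.Relation.Unary.AllPairs.Properties as AllPairs
open import Data.List.Relation.Unary.Any as Any using (Any; here; there)
import Data.List.Relation.Unary.Any.Properties as Any
open import Data.List.Relation.Unary.Linked as Linked using (Linked; []; [-]; _∷_)
import Data.List.Relation.Unary.Linked.Properties as Linked
open import Data.List.Relation.Unary.Unique.Propositional using (Unique)
import Data.List.Relation.Unary.Unique.Propositional.Properties as Unique
open import Data.Nat.Base
  using (ℕ; zero; suc; _+_; _*_; _∸_; _^_; _≤_; _<_; _≥_; z≤n; s≤s; _≤ᵇ_; _<ᵇ_; ∣_-_∣; NonZero; >-nonZero)
open import Data.Nat.ListAction using (sum)
open import Data.Nat.ListAction.Properties using (sum-↭; sum-++)
open import Data.Nat.Properties
open import Data.Nat.Tactic.RingSolver using (solve-∀)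
open import Data.Product.Base using (_×_; _,_; proj₁; proj₂; Σ-syntax; ∃-syntax; ∃; ∃₂; map₁; map₂; swap)
open import Data.Product.Properties using (≡-dec)
open import Data.Rational.Unnormalised.Base using (ℚᵘ; mkℚᵘ; 0ℚᵘ; _/_)
import Data.Rational.Unnormalised.Base as ℚᵘ
open import Data.Sum.Base using (_⊎_; inj₁; inj₂; [_,_]′)
open import Data.Unit.Base using (tt)
open import Data.Vec.Base as Vec using (Vec; []; _∷_)
import Data.Vec.Properties as Vec
open import Function.Base using (_∘_; id; case_of_)
open import Function.Bundles using (_↔_; module Inverse)
open import Function.Construct.Identity using (↔-id)
open import Function.Construct.Symmetry using (↔-sym)
open import Relation.Binary.Definitions using (tri<; tri≈; tri>)
open import Relation.Binary.PropositionalEquality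
  using (_≡_; _≢_; refl; sym; trans; cong; cong₂; subst; subst₂; setoid)
open import Relation.Nullary.Decidable using (Dec; yes; no; does; T?; map′; _×-dec_; _⊎-dec_; _→-dec_; ¬?; decidable-stable)
open import Relation.Nullary.Negation using (¬_; contradiction)
open import Defs

-- Pairs of vertices suffice because a cell of the grid has at most two neighbours on an adjacent
-- diagonal; n common neighbours per pair leave room to choose the entries of a row greedily and
-- distinct. The danger is a loss that accumulates over 2n - 1 steps. In red, each step starts from
-- a whole cluster of s = 2 d^(r+1) u₀ vertices and cuts the result back to u₀, so the subsets never
-- shrink. In blue, the parts of the path are thinned from its end and each is halved only once, so
-- a constant density 2/d with d = 32 is small enough. Dependent random choice removes the bad pairs
-- once m^r is at least 2s, where u₀ = d n m; with r fixed and large, m can be a small power of n.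
-- The edge count O(n) (n m)^2 then exceeds n^3 only by a constant times m^2, and that is the o(1).
-- Nothing is random: the graph H comes from a greedy hitting set, the common neighbourhoods from
-- repeated averaging.

private variable
  A B C Point Test : Set

-- Sums and counts over lists, and averaging.

ind : Bool → ℕ
ind false = 0
ind true  = 1

ind-∧ : ∀ a b → ind (a ∧ b) ≡ ind a * ind b
ind-∧ false b = refl
ind-∧ true  b = sym (+-identityʳ (ind b))

ind-not : ∀ a → ind a + ind (not a) ≡ 1
ind-not false = refl
ind-not true  = refl

ind≤1 : ∀ a → ind a ≤ 1
ind≤1 false = z≤n
ind≤1 true  = ≤-refl

T⇒≡true : ∀ {b} → T b → b ≡ true
T⇒≡true {true} _ = refl

≡true⇒T : ∀ {b} → b ≡ true → T b
≡true⇒T refl = tt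

∧-true : ∀ {a b} → a ∧ b ≡ true → a ≡ true × b ≡ true
∧-true {true} {true} _ = refl , refl

infix 10 ∑
∑ : List A → (A → ℕ) → ℕ
∑ xs f = sum (map f xs)

syntax ∑ xs (λ x → t) = ∑[ x ← xs ] t

count : (A → Bool) → List A → ℕ
count p xs = ∑ xs (ind ∘ p)

∑-mono : ∀ (xs : List A) {f g : A → ℕ} → (∀ {x} → x ∈ xs → f x ≤ g x) → ∑ xs f ≤ ∑ xs g
∑-mono []       f≤g = z≤n
∑-mono (x ∷ xs) f≤g = +-mono-≤ (f≤g (here refl)) (∑-mono xs (f≤g ∘ there))

∑-cong : ∀ (xs : List A) {f g : A → ℕ} → (∀ x → f x ≡ g x) → ∑ xs f ≡ ∑ xs g
∑-cong []       f≡g = refl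
∑-cong (x ∷ xs) f≡g = cong₂ _+_ (f≡g x) (∑-cong xs f≡g)

∑-+ : ∀ (xs : List A) (f g : A → ℕ) → ∑ xs (λ x → f x + g x) ≡ ∑ xs f + ∑ xs g
∑-+ []       f g = refl
∑-+ (x ∷ xs) f g = trans (cong (f x + g x +_) (∑-+ xs f g)) (interchange (f x) (g x) _ _)
  where
  interchange : ∀ a b c d → a + b + (c + d) ≡ a + c + (b + d)
  interchange = solve-∀

∑-*ˡ : ∀ (xs : List A) k (f : A → ℕ) → ∑ xs (λ x → k * f x) ≡ k * ∑ xs f
∑-*ˡ []       k f = sym (*-zeroʳ k)
∑-*ˡ (x ∷ xs) k f = trans (cong (k * f x +_) (∑-*ˡ xs k f)) (sym (*-distribˡ-+ k (f x) _))

∑-*ʳ : ∀ (xs : List A) k (f : A → ℕ) → ∑ xs (λ x → f x * k) ≡ ∑ xs f * k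
∑-*ʳ xs k f = trans (∑-cong xs (λ x → *-comm (f x) k)) (trans (∑-*ˡ xs k f) (*-comm k _))

∑-const : ∀ (xs : List A) k → ∑ xs (λ _ → k) ≡ length xs * k
∑-const []       k = refl
∑-const (x ∷ xs) k = cong (k +_) (∑-const xs k)

∑-swap : ∀ (xs : List A) (ys : List B) (f : A → B → ℕ) →
         ∑[ x ← xs ] ∑[ y ← ys ] f x y ≡ ∑[ y ← ys ] ∑[ x ← xs ] f x y
∑-swap []       ys f = sym (trans (∑-const ys 0) (*-zeroʳ (length ys)))
∑-swap (x ∷ xs) ys f = trans (cong (∑ ys (f x) +_) (∑-swap xs ys f)) (sym (∑-+ ys (f x) _))

∑-++ : ∀ (xs ys : List A) (f : A → ℕ) → ∑ (xs ++ ys) f ≡ ∑ xs f + ∑ ys f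
∑-++ xs ys f = trans (cong sum (List.map-++ f xs ys)) (sum-++ (map f xs) (map f ys))

∑-map : ∀ (h : A → B) (xs : List A) (f : B → ℕ) → ∑ (map h xs) f ≡ ∑ xs (f ∘ h)
∑-map h xs f = cong sum (sym (List.map-∘ xs))

∑-↭ : ∀ {xs ys : List A} (f : A → ℕ) → xs ↭ ys → ∑ xs f ≡ ∑ ys f
∑-↭ f xs↭ys = sum-↭ (↭.map⁺ f xs↭ys)

∑-filter : ∀ (p : A → Bool) (xs : List A) (f : A → ℕ) →
           ∑ (filterᵇ p xs) f ≡ ∑[ x ← xs ] (ind (p x) * f x)
∑-filter p []       f = refl
∑-filter p (x ∷ xs) f with p x
... | false = ∑-filter p xs f
... | true  = cong₂ _+_ (sym (+-identityʳ (f x))) (∑-filter p xs f)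

∑-product : ∀ (xs : List A) (ys : List B) (f : A × B → ℕ) →
            ∑ (cartesianProduct xs ys) f ≡ ∑[ x ← xs ] ∑[ y ← ys ] f (x , y)
∑-product []       ys f = refl
∑-product (x ∷ xs) ys f = trans (∑-++ (map (x ,_) ys) _ f)
  (cong₂ _+_ (∑-map (x ,_) ys f) (∑-product xs ys f))

length-filterᵇ : ∀ (p : A → Bool) (xs : List A) → length (filterᵇ p xs) ≡ count p xs
length-filterᵇ p []       = refl
length-filterᵇ p (x ∷ xs) with p x
... | false = length-filterᵇ p xs
... | true  = cong suc (length-filterᵇ p xs)

count-not : ∀ (p : A → Bool) (xs : List A) → count p xs + count (not ∘ p) xs ≡ length xs
count-not p xs = trans (sym (∑-+ xs (ind ∘ p) (ind ∘ not ∘ p)))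
  (trans (∑-cong xs (ind-not ∘ p)) (trans (∑-const xs 1) (*-identityʳ _)))

count≤length : ∀ (p : A → Bool) (xs : List A) → count p xs ≤ length xs
count≤length p xs = ≤-trans (m≤m+n _ _) (≤-reflexive (count-not p xs))

count-∈ : ∀ (p : A → Bool) {xs : List A} {x} → x ∈ xs → p x ≡ true → 1 ≤ count p xs
count-∈ p {x ∷ xs} (here refl) px rewrite px = s≤s z≤n
count-∈ p {y ∷ xs} (there x∈) px = ≤-trans (count-∈ p x∈ px) (m≤n+m _ (ind (p y)))

∑<⇒∃< : ∀ (xs : List A) (f g : A → ℕ) → ∑ xs f < ∑ xs g → ∃[ x ] x ∈ xs × f x < g x
∑<⇒∃< (x ∷ xs) f g lt with <-≤-connex (f x) (g x)
... | inj₁ fx<gx = x , here refl , fx<gx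
... | inj₂ gx≤fx with ∑<⇒∃< xs f g (+-cancelˡ-< (g x) _ _ (≤-<-trans (+-monoˡ-≤ _ gx≤fx) lt))
...   | y , y∈xs , fy<gy = y , there y∈xs , fy<gy

averaging : ∀ (xs : List A) (f g : A → ℕ) → 1 ≤ length xs → ∑ xs f ≤ ∑ xs g → ∃[ x ] x ∈ xs × f x ≤ g x
averaging xs f g nonempty le with ∑<⇒∃< xs f (suc ∘ g) (≤-<-trans le lt)
  where
  lt : ∑ xs g < ∑ xs (suc ∘ g)
  lt = ≤-trans (+-monoˡ-≤ (∑ xs g) nonempty)
    (≤-reflexive (sym (trans (∑-+ xs (λ _ → 1) g)
      (cong (_+ ∑ xs g) (trans (∑-const xs 1) (*-identityʳ _))))))
... | x , x∈xs , fx<1+gx = x , x∈xs , ≤-pred fx<1+gx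

∈-filterᵇ⁻ : ∀ (p : A → Bool) xs {x} → x ∈ filterᵇ p xs → x ∈ xs × p x ≡ true
∈-filterᵇ⁻ p xs x∈ = map₂ T⇒≡true (∈-filter⁻ (T? ∘ p) x∈)

∈-filterᵇ⁺ : ∀ (p : A → Bool) {xs x} → x ∈ xs → p x ≡ true → x ∈ filterᵇ p xs
∈-filterᵇ⁺ p x∈ px = ∈-filter⁺ (T? ∘ p) x∈ (≡true⇒T px)

Unique-filterᵇ : ∀ (p : A → Bool) {xs} → Unique xs → Unique (filterᵇ p xs)
Unique-filterᵇ p = Unique.filter⁺ (T? ∘ p)

take-⊆ : ∀ k (xs : List A) → take k xs ⊆ xs
take-⊆ (suc k) (x ∷ xs) (here px)  = here px
take-⊆ (suc k) (x ∷ xs) (there p) = there (take-⊆ k xs p)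

length-take-≤ : ∀ k (xs : List A) → k ≤ length xs → length (take k xs) ≡ k
length-take-≤ k xs k≤ = trans (List.length-take k xs) (m≤n⇒m⊓n≡m k≤)

Unique-⊆⇒length≤ : ∀ {xs ys : List A} → Unique xs → xs ⊆ ys → length xs ≤ length ys
Unique-⊆⇒length≤ {xs = []}     _          _     = z≤n
Unique-⊆⇒length≤ {xs = x ∷ xs} (x# ∷ uniq) xs⊆ys with ∈-∃++ (xs⊆ys (here refl))
... | as , bs , refl = subst (suc (length xs) ≤_)
        (sym (↭.↭-length (↭.shift x as bs)))
        (s≤s (Unique-⊆⇒length≤ uniq remove))
  where
  remove : xs ⊆ as ++ bs
  remove y∈xs with ↭.∈-resp-↭ (↭.shift x as bs) (xs⊆ys (there y∈xs))
  ... | here refl = contradiction refl (All.lookup x# y∈xs)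
  ... | there y∈  = y∈

-- Greedy hitting sets.

missed : (Test → Point → Bool) → List Point → Test → Bool
missed test hs f = not (any (test f) hs)

-- Each greedy choice hits a fraction 1/(k+1) of the tests that are still missed.
hitting : ∀ (test : Test → Point → Bool) k (pts : List Point) → 1 ≤ length pts →
          ∀ t (fam : List Test) → (∀ {f} → f ∈ fam → length pts ≤ suc k * count (test f) pts) →
          ∃[ hs ] length hs ≤ t × count (missed test hs) fam * suc k ^ t ≤ k ^ t * length fam
hitting test k pts nonempty zero fam dense = [] , z≤n , ≤-reflexive
  (trans (*-identityʳ _) (trans (∑-const fam 1) (*-comm (length fam) 1)))
hitting {Test = Test} {Point = Point} test k pts nonempty (suc t) fam dense
  with averaging pts (λ _ → length fam) (λ x → suc k * count (λ f → test f x) fam) nonempty total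
  where
  open ≤-Reasoning
  total : ∑[ _ ← pts ] length fam ≤ ∑[ x ← pts ] (suc k * count (λ f → test f x) fam)
  total = begin
    ∑[ _ ← pts ] length fam                             ≡⟨ ∑-const pts _ ⟩
    length pts * length fam                             ≡⟨ *-comm (length pts) _ ⟩
    length fam * length pts                             ≡⟨ ∑-const fam _ ⟨
    ∑[ _ ← fam ] length pts                             ≤⟨ ∑-mono fam dense ⟩
    ∑[ f ← fam ] (suc k * count (test f) pts)           ≡⟨ ∑-*ˡ fam (suc k) _ ⟩
    suc k * ∑[ f ← fam ] ∑[ x ← pts ] ind (test f x)    ≡⟨ cong (suc k *_) (∑-swap fam pts _) ⟩
    suc k * ∑[ x ← pts ] count (λ f → test f x) fam     ≡⟨ ∑-*ˡ pts (suc k) _ ⟨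
    ∑[ x ← pts ] (suc k * count (λ f → test f x) fam)   ∎
... | x , _ , hit with hitting test k pts nonempty t (filterᵇ (λ f → not (test f x)) fam)
                         (λ f∈ → dense (proj₁ (∈-filterᵇ⁻ (λ f → not (test f x)) fam f∈)))
...   | hs , |hs|≤t , few = x ∷ hs , s≤s |hs|≤t , bound
  where
  open ≤-Reasoning
  rest : List Test
  rest = filterᵇ (λ f → not (test f x)) fam

  not-∨ : ∀ a b → ind (not (a ∨ b)) ≡ ind (not a) * ind (not b)
  not-∨ true  b = refl
  not-∨ false b = sym (+-identityʳ _)

  missed-rest : count (missed test (x ∷ hs)) fam ≡ count (missed test hs) rest
  missed-rest = trans (∑-cong fam (λ f → not-∨ (test f x) _)) (sym (∑-filter _ fam _))

  shrink : suc k * length rest ≤ k * length fam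
  shrink = +-cancelˡ-≤ (length fam) _ _ (begin
    length fam + suc k * length rest                                   ≤⟨ +-monoˡ-≤ _ hit ⟩
    suc k * count (λ f → test f x) fam + suc k * length rest           ≡⟨ *-distribˡ-+ (suc k) (count (λ f → test f x) fam) _ ⟨
    suc k * (count (λ f → test f x) fam + length rest)                 ≡⟨ cong (λ z → suc k * (count (λ f → test f x) fam + z)) (length-filterᵇ _ fam) ⟩
    suc k * (count (λ f → test f x) fam + count (λ f → not (test f x)) fam) ≡⟨ cong (suc k *_) (count-not _ fam) ⟩
    suc k * length fam                                                 ∎)

  rearrange : ∀ a b c → a * (b * c) ≡ b * (a * c)
  rearrange = solve-∀

  bound : count (missed test (x ∷ hs)) fam * suc k ^ suc t ≤ k ^ suc t * length fam
  bound = begin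
    count (missed test (x ∷ hs)) fam * (suc k * suc k ^ t) ≡⟨ cong (_* (suc k * suc k ^ t)) missed-rest ⟩
    count (missed test hs) rest * (suc k * suc k ^ t)      ≡⟨ rearrange (count (missed test hs) rest) (suc k) _ ⟩
    suc k * (count (missed test hs) rest * suc k ^ t)      ≤⟨ *-monoʳ-≤ (suc k) few ⟩
    suc k * (k ^ t * length rest)                          ≡⟨ rearrange (suc k) (k ^ t) _ ⟩
    k ^ t * (suc k * length rest)                          ≤⟨ *-monoʳ-≤ (k ^ t) shrink ⟩
    k ^ t * (k * length fam)                               ≡⟨ rearrange (k ^ t) k _ ⟩
    k * (k ^ t * length fam)                               ≡⟨ *-assoc k (k ^ t) _ ⟨
    k ^ suc t * length fam                                 ∎

-- The number of missed tests times (k+1)^t is below (k+1)^t, so it is zero.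
hitting-all : ∀ (test : Test → Point → Bool) k (pts : List Point) → 1 ≤ length pts →
              ∀ t (fam : List Test) → (∀ {f} → f ∈ fam → length pts ≤ suc k * count (test f) pts) →
              k ^ t * length fam < suc k ^ t →
              ∃[ hs ] length hs ≤ t × (∀ {f} → f ∈ fam → any (test f) hs ≡ true)
hitting-all test k pts nonempty t fam dense small
  with hitting test k pts nonempty t fam dense
... | hs , |hs|≤t , few = hs , |hs|≤t , all-hit
  where
  all-hit : ∀ {f} → f ∈ fam → any (test f) hs ≡ true
  all-hit {f} f∈fam with any (test f) hs in eq
  ... | true  = refl
  ... | false = contradiction (≤-<-trans (≤-trans one few) small) (<-irrefl refl)
    where
    one : suc k ^ t ≤ count (missed test hs) fam * suc k ^ t
    one = ≤-trans (≤-reflexive (sym (*-identityˡ _)))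
            (*-monoˡ-≤ (suc k ^ t) (count-∈ (missed test hs) f∈fam (cong not eq)))

-- A graph with linearly many edges that joins any two large sets.

bitVectors : ∀ n → List (Vec Bool n)
bitVectors zero    = [ [] ]
bitVectors (suc n) = map (true ∷_) (bitVectors n) ++ map (false ∷_) (bitVectors n)

length-bitVectors : ∀ n → length (bitVectors n) ≡ 2 ^ n
length-bitVectors zero    = refl
length-bitVectors (suc n) = trans (List.length-++ (map (true ∷_) (bitVectors n)))
  (cong₂ _+_ (trans (List.length-map _ (bitVectors n)) (length-bitVectors n))
    (trans (List.length-map _ (bitVectors n)) (trans (length-bitVectors n) (sym (+-identityʳ _)))))

∈-bitVectors : ∀ {n} (v : Vec Bool n) → v ∈ bitVectors n
∈-bitVectors []          = here refl
∈-bitVectors (true ∷ v)  = ∈-++⁺ˡ (∈-map⁺ (true ∷_) (∈-bitVectors v))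
∈-bitVectors (false ∷ v) = ∈-++⁺ʳ (map (true ∷_) (bitVectors _)) (∈-map⁺ (false ∷_) (∈-bitVectors v))

length-productWith : ∀ (f : A → B → C) xs ys → length (cartesianProductWith f xs ys) ≡ length xs * length ys
length-productWith f []       ys = refl
length-productWith f (x ∷ xs) ys = trans (List.length-++ (map (f x) ys))
  (cong₂ _+_ (List.length-map _ ys) (length-productWith f xs ys))

length-allFin : ∀ n → length (allFin n) ≡ n
length-allFin n = List.length-tabulate {n = n} id

^-distribʳ-* : ∀ k m n → (m * n) ^ k ≡ m ^ k * n ^ k
^-distribʳ-* zero    m n = refl
^-distribʳ-* (suc k) m n = trans (cong (m * n *_) (^-distribʳ-* k m n)) (interchange m n _ _)
  where
  interchange : ∀ a b c d → a * b * (c * d) ≡ a * c * (b * d)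
  interchange = solve-∀

-- One numerical inequality, checked for a single `t`, is raised to the power `l` and so serves
-- expanders of every size.
power-gap : ∀ a b c t l → 1 ≤ l → b ^ t * c < a ^ t → b ^ (t * l) * c ^ l < a ^ (t * l)
power-gap a b c t l 1≤l gap = begin-strict
  b ^ (t * l) * c ^ l ≡⟨ cong (_* c ^ l) (^-*-assoc b t l) ⟨
  (b ^ t) ^ l * c ^ l ≡⟨ ^-distribʳ-* l (b ^ t) c ⟨
  (b ^ t * c) ^ l     <⟨ ^-monoˡ-< l {{>-nonZero 1≤l}} gap ⟩
  (a ^ t) ^ l         ≡⟨ ^-*-assoc a t l ⟩
  a ^ (t * l)         ∎
  where open ≤-Reasoning

-- There are at most 4^(7L) pairs of vertex sets to be joined, and a pair of sets of size L
-- spans a fraction 1/49 of all (7L)² pairs of vertices.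
expander : ∀ t → 48 ^ t * 4 ^ 7 < 49 ^ t → ∀ L → 1 ≤ L →
  ∃[ hs ] length hs ≤ t * L ×
  (∀ (xs ys : List (Fin (7 * L))) → Unique xs → Unique ys → L ≤ length xs → L ≤ length ys →
   ∃₂ λ x y → x ∈ xs × y ∈ ys × (x , y) ∈ hs)
expander t gap L 1≤L = hs , proj₁ (proj₂ found) , joins
  where
  N : ℕ
  N = 7 * L

  pts : List (Fin N × Fin N)
  pts = cartesianProduct (allFin N) (allFin N)

  size : Vec Bool N → ℕ
  size v = count (Vec.lookup v) (allFin N)

  large : Vec Bool N × Vec Bool N → Bool
  large (v , w) = (L ≤ᵇ size v) ∧ (L ≤ᵇ size w)

  -- The two sets may overlap, so a pair (x, x) can be the one that hits them. Disjointness is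
  -- supplied where `joins` is applied.
  fam : List (Vec Bool N × Vec Bool N)
  fam = filterᵇ large (cartesianProduct (bitVectors N) (bitVectors N))

  test : Vec Bool N × Vec Bool N → Fin N × Fin N → Bool
  test (v , w) (x , y) = Vec.lookup v x ∧ Vec.lookup w y

  |pts| : length pts ≡ N * N
  |pts| = trans (length-productWith _,_ (allFin N) (allFin N)) (cong₂ _*_ (length-allFin N) (length-allFin N))

  1≤N : 1 ≤ N
  1≤N = ≤-trans 1≤L (m≤m+n L (6 * L))

  count-test : ∀ v w → count (test (v , w)) pts ≡ size v * size w
  count-test v w = trans (∑-product (allFin N) (allFin N) _)
    (trans (∑-cong (allFin N) λ x → trans (∑-cong (allFin N) λ y → ind-∧ (Vec.lookup v x) _)
      (∑-*ˡ (allFin N) (ind (Vec.lookup v x)) _))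
    (∑-*ʳ (allFin N) (size w) _))

  49L² : ∀ l → (7 * l) * (7 * l) ≡ 49 * (l * l)
  49L² = solve-∀

  dense : ∀ {f} → f ∈ fam → length pts ≤ 49 * count (test f) pts
  dense {v , w} f∈ = subst₂ _≤_ (sym (trans |pts| (49L² L))) (cong (49 *_) (sym (count-test v w)))
    (*-monoʳ-≤ 49 (*-mono-≤ (≤ᵇ⇒≤ L _ (≡true⇒T (proj₁ both))) (≤ᵇ⇒≤ L _ (≡true⇒T (proj₂ both)))))
    where both = ∧-true {L ≤ᵇ size v} (proj₂ (∈-filterᵇ⁻ large (cartesianProduct (bitVectors N) (bitVectors N)) f∈))

  |fam| : length fam ≤ (4 ^ 7) ^ L
  |fam| = begin
    length fam                   ≤⟨ List.length-filter (T? ∘ large) (cartesianProduct (bitVectors N) (bitVectors N)) ⟩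
    length (cartesianProduct (bitVectors N) (bitVectors N)) ≡⟨ length-productWith _,_ (bitVectors N) (bitVectors N) ⟩
    length (bitVectors N) * length (bitVectors N) ≡⟨ cong₂ _*_ (length-bitVectors N) (length-bitVectors N) ⟩
    2 ^ N * 2 ^ N                ≡⟨ ^-distribʳ-* N 2 2 ⟨
    4 ^ (7 * L)                  ≡⟨ ^-*-assoc 4 7 L ⟨
    (4 ^ 7) ^ L                  ∎
    where open ≤-Reasoning

  small : 48 ^ (t * L) * length fam < 49 ^ (t * L)
  small = ≤-<-trans (*-monoʳ-≤ (48 ^ (t * L)) |fam|) (power-gap 49 48 (4 ^ 7) t L 1≤L gap)

  found : ∃[ hs ] length hs ≤ t * L × (∀ {f} → f ∈ fam → any (test f) hs ≡ true)
  found = hitting-all test 48 pts (subst (1 ≤_) (sym |pts|) (*-mono-≤ 1≤N 1≤N)) (t * L) fam dense small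

  hs : List (Fin N × Fin N)
  hs = proj₁ found

  indicator : List (Fin N) → Vec Bool N
  indicator xs = Vec.tabulate (λ i → does (Any.any? (i Fin.≟_) xs))

  indicator-sound : ∀ xs i → Vec.lookup (indicator xs) i ≡ true → i ∈ xs
  indicator-sound xs i eq with Any.any? (i Fin.≟_) xs | Vec.lookup∘tabulate (λ i → does (Any.any? (i Fin.≟_) xs)) i
  ... | yes i∈xs | _  = i∈xs
  ... | no _     | eq′ with () ← trans (sym eq) eq′

  indicator-complete : ∀ xs i → i ∈ xs → Vec.lookup (indicator xs) i ≡ true
  indicator-complete xs i i∈xs with Any.any? (i Fin.≟_) xs | Vec.lookup∘tabulate (λ i → does (Any.any? (i Fin.≟_) xs)) i
  ... | yes _   | eq = eq
  ... | no i∉xs | _  = contradiction i∈xs i∉xs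

  size-indicator : ∀ xs → Unique xs → L ≤ length xs → (L ≤ᵇ size (indicator xs)) ≡ true
  size-indicator xs uniq L≤ = T⇒≡true (≤⇒≤ᵇ (≤-trans L≤ (≤-trans
    (Unique-⊆⇒length≤ uniq (λ {i} i∈ → ∈-filterᵇ⁺ (Vec.lookup (indicator xs)) (∈-allFin i) (indicator-complete xs i i∈)))
    (≤-reflexive (length-filterᵇ (Vec.lookup (indicator xs)) (allFin N))))))

  any-∈ : ∀ (p : Point → Bool) zs → any p zs ≡ true → ∃[ z ] z ∈ zs × p z ≡ true
  any-∈ p (z ∷ zs) eq with p z in pz
  ... | true  = z , here refl , pz
  ... | false = map₂ (map₁ there) (any-∈ p zs eq)

  joins : ∀ (xs ys : List (Fin N)) → Unique xs → Unique ys → L ≤ length xs → L ≤ length ys →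
          ∃₂ λ x y → x ∈ xs × y ∈ ys × (x , y) ∈ hs
  joins xs ys uxs uys L≤xs L≤ys
    with any-∈ (test (indicator xs , indicator ys)) hs
           (proj₂ (proj₂ found) (∈-filterᵇ⁺ large
             (∈-cartesianProduct⁺ (∈-bitVectors (indicator xs)) (∈-bitVectors (indicator ys)))
             (cong₂ _∧_ (size-indicator xs uxs L≤xs) (size-indicator ys uys L≤ys))))
  ... | (x , y) , xy∈hs , eq with ∧-true {Vec.lookup (indicator xs) x} eq
  ...   | ex , ey = x , y , indicator-sound xs x ex , indicator-sound ys y ey , xy∈hs

-- The ratio of the logarithms of 4^7 and 49/48 is about 470.6. The Boolean comparison is evaluated
-- on built-in numbers.
480-steps-suffice : 48 ^ 480 * 4 ^ 7 < 49 ^ 480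
480-steps-suffice = <ᵇ⇒< (48 ^ 480 * 4 ^ 7) (49 ^ 480) tt

-- Depth-first search for long chains.

-- A depth-first search keeps a stack of linked states, a list of exhausted states
-- and a list of unvisited items; no exhausted state can be extended by an unvisited item.
module Search
  {Item State : Set} (item : State → Item)
  (Link : State → State → Set) (Sep : State → Item → Set)
  (root : Item → State) (item-root : ∀ i → item (root i) ≡ i)
  (step : ∀ x i → (∃[ y ] item y ≡ i × Link y x) ⊎ Sep x i)
  where

  -- A state may hold more than its item, namely data fixed on arrival such as the subset chosen in
  -- a cluster. Permutations are therefore stated for items.
  LongChain : ℕ → List Item → Set
  LongChain l items = ∃₂ λ stack rest →
    length stack ≡ l × Linked Link stack × map item stack ++ rest ↭ items

  Separation : ℕ → ℕ → List Item → Set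
  Separation l w items = ∃[ stack ] ∃₂ λ dead fresh →
    length stack < l × length dead ≡ w × map item stack ++ map item dead ++ fresh ↭ items ×
    (∀ {x i} → x ∈ dead → i ∈ fresh → Sep x i)

  extend : ∀ x fresh → (∃[ y ] ∃[ fresh′ ] Link y x × item y ∷ fresh′ ↭ fresh) ⊎ (∀ {i} → i ∈ fresh → Sep x i)
  extend x []       = inj₂ λ ()
  extend x (i ∷ is) with step x i
  ... | inj₁ (y , refl , link) = inj₁ (y , is , link , ↭-refl)
  ... | inj₂ sep with extend x is
  ...   | inj₁ (y , is′ , link , perm) = inj₁ (y , i ∷ is′ , link ,
            ↭-trans (_↭_.swap (item y) i ↭-refl) (prep i perm))
  ...   | inj₂ seps = inj₂ λ { (here refl) → sep ; (there i∈) → seps i∈ }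

  module _ (items : List Item) (l w : ℕ) (enough : 2 * w + l ≤ length items) where

    -- An item moves from unvisited to the stack and from there to exhausted; each move lowers
    -- `2 * length fresh + length stack` by one. Stack and exhausted list grow by single entries, so
    -- the search can stop exactly when one of them reaches its target.
    explore : ∀ fuel stack dead fresh → 2 * length fresh + length stack ≤ fuel →
              Linked Link stack → length stack ≤ l → length dead ≤ w →
              map item stack ++ map item dead ++ fresh ↭ items →
              (∀ {x i} → x ∈ dead → i ∈ fresh → Sep x i) →
              LongChain l items ⊎ Separation l w items
    explore fuel stack dead fresh fuel≥ linked stack≤ dead≤ perm sep
      with m≤n⇒m<n∨m≡n stack≤
    ... | inj₂ stack≡ = inj₁ (stack , _ , stack≡ , linked , perm)
    ... | inj₁ stack< with m≤n⇒m<n∨m≡n dead≤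
    ...   | inj₂ dead≡ = inj₂ (stack , dead , fresh , stack< , dead≡ , perm , sep)
    ...   | inj₁ dead< = continue fuel stack fresh fuel≥ linked stack< perm sep
      where
      continue : ∀ fuel stack fresh → 2 * length fresh + length stack ≤ fuel →
                 Linked Link stack → length stack < l →
                 map item stack ++ map item dead ++ fresh ↭ items →
                 (∀ {x i} → x ∈ dead → i ∈ fresh → Sep x i) →
                 LongChain l items ⊎ Separation l w items
      -- Otherwise all items would be among fewer than `w` exhausted states.
      continue fuel [] [] _ _ _ perm _ = contradiction
        (≤-<-trans enough (subst (_< 2 * w + l) (↭.↭-length perm) few)) (<-irrefl refl)
        where
        few : length (map item dead ++ []) < 2 * w + l
        few = ≤-<-trans
          (≤-reflexive (trans (cong length (List.++-identityʳ (map item dead))) (List.length-map item dead)))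
          (<-≤-trans dead< (≤-trans (m≤m+n w (w + 0)) (m≤m+n (2 * w) l)))
      continue (suc fuel) [] (i ∷ is) fuel≥ _ stack< perm sep =
        explore fuel [ root i ] dead is
          (≤-pred (≤-trans (≤-reflexive (measure (length is))) fuel≥)) [-] stack< dead≤
          (↭-trans (↭-trans (prep _ ↭-refl) (↭-sym (subst (λ j → map item dead ++ i ∷ is ↭ j ∷ map item dead ++ is)
            (sym (item-root i)) (↭.shift i (map item dead) is)))) perm)
          (λ x∈ j∈ → sep x∈ (there j∈))
        where
        measure : ∀ n → suc (2 * n + 1) ≡ 2 * suc n + 0
        measure = solve-∀
      continue zero (x ∷ xs) is fuel≥ = contradiction (≤-trans (m≤n+m _ (2 * length is)) fuel≥) λ ()
      continue (suc fuel) (x ∷ xs) is fuel≥ linked stack< perm sep with extend x is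
      ... | inj₁ (y , is′ , link , perm′) =
        explore fuel (y ∷ x ∷ xs) dead is′
          (≤-pred (≤-trans (≤-reflexive (trans (measure (length is′) (length xs))
            (cong (λ n → 2 * n + suc (length xs)) (↭.↭-length perm′)))) fuel≥))
          (link ∷ linked) stack< dead≤
          (↭-trans (↭-trans (↭-sym (↭.shift (item y) (map item (x ∷ xs)) _))
            (↭.++⁺ˡ (map item (x ∷ xs)) (↭-trans (↭-sym (↭.shift (item y) (map item dead) is′))
              (↭.++⁺ˡ (map item dead) perm′)))) perm)
          (λ x∈ i∈ → sep x∈ (↭.∈-resp-↭ perm′ (there i∈)))
        where
        measure : ∀ n k → suc (2 * n + suc (suc k)) ≡ 2 * suc n + suc k
        measure = solve-∀
      ... | inj₂ seps =
        explore fuel xs (x ∷ dead) is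
          (≤-pred (≤-trans (≤-reflexive (sym (+-suc (2 * length is) (length xs)))) fuel≥))
          (Linked.tail linked) (<⇒≤ (<-trans (n<1+n _) stack<)) dead<
          (↭-trans (↭.shift (item x) (map item xs) _) perm)
          (λ { (here refl) → seps ; (there x∈) → sep x∈ })

    search : LongChain l items ⊎ Separation l w items
    search = explore (2 * length items + 0) [] [] items ≤-refl [] z≤n z≤n ↭-refl λ ()

-- Dependent random choice.

-- Chains x - y ≤ q - p ≤ w - z without truncated subtraction.
+-cancel-cross : ∀ x y z w p q → x + p ≤ y + q → q + z ≤ p + w → x + z ≤ y + w
+-cancel-cross x y z w p q h₁ h₂ = +-cancelʳ-≤ (p + q) _ _ (begin
  x + z + (p + q)   ≡⟨ regroup x z p q ⟩
  x + p + (q + z)   ≤⟨ +-mono-≤ h₁ h₂ ⟩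
  y + q + (p + w)   ≡⟨ regroup′ y q p w ⟩
  y + w + (p + q)   ∎)
  where
  open ≤-Reasoning
  regroup : ∀ a b c d → a + b + (c + d) ≡ a + c + (d + b)
  regroup = solve-∀
  regroup′ : ∀ a b c d → a + b + (c + d) ≡ a + d + (c + b)
  regroup′ = solve-∀

module DependentChoice {A B : Set} (ρ : A → B → Bool) (n : ℕ) (U : List A) where

  degree : B → ℕ
  degree v = count (λ u → ρ u v) U

  codegree : B → B → ℕ
  codegree v v′ = count (λ u → ρ u v ∧ ρ u v′) U

  -- The case v = v′ is included: a vertex of degree below n is poor with itself. This is used at
  -- the last index of a row, which `next` fixes.
  poor : B → B → Bool
  poor v v′ = codegree v v′ <ᵇ n

  poorPairs : List B → ℕ
  poorPairs W = ∑[ v ← W ] ∑[ v′ ← W ] ind (poor v v′)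

  poorPairs≤ : ∀ W → poorPairs W ≤ length W * length W
  poorPairs≤ W = ≤-trans (∑-mono W (λ _ → ≤-trans (∑-mono W (λ _ → ind≤1 _))
    (≤-reflexive (trans (∑-const W 1) (*-identityʳ _))))) (≤-reflexive (∑-const W (length W)))

  neighbours : A → List B → List B
  neighbours u = filterᵇ (ρ u)

  ∑-neighbours : ∀ a W → (∀ {v} → v ∈ W → a ≤ degree v) → a * length W ≤ ∑[ u ← U ] length (neighbours u W)
  ∑-neighbours a W rich = begin
    a * length W                        ≡⟨ *-comm a _ ⟩
    length W * a                        ≡⟨ ∑-const W a ⟨
    ∑[ _ ← W ] a                        ≤⟨ ∑-mono W rich ⟩
    ∑[ v ← W ] ∑[ u ← U ] ind (ρ u v)   ≡⟨ ∑-swap W U _ ⟩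
    ∑[ u ← U ] count (ρ u) W            ≡⟨ ∑-cong U (λ u → length-filterᵇ (ρ u) W) ⟨
    ∑[ u ← U ] length (neighbours u W)  ∎
    where open ≤-Reasoning

  poorPairs-neighbours : ∀ u W → poorPairs (neighbours u W) ≡
    ∑[ v ← W ] ∑[ v′ ← W ] (ind (ρ u v ∧ ρ u v′) * ind (poor v v′))
  poorPairs-neighbours u W = trans (∑-filter (ρ u) W _) (∑-cong W λ v →
    trans (cong (ind (ρ u v) *_) (∑-filter (ρ u) W _))
    (trans (sym (∑-*ˡ W (ind (ρ u v)) _))
    (∑-cong W λ v′ → trans (sym (*-assoc (ind (ρ u v)) _ _))
      (cong (_* ind (poor v v′)) (sym (ind-∧ (ρ u v) _))))))

  -- A poor pair survives only in the neighbourhoods of its common neighbours, of which there are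
  -- fewer than n.
  ∑-poorPairs : ∀ W → ∑[ u ← U ] poorPairs (neighbours u W) ≤ n * poorPairs W
  ∑-poorPairs W = begin
    ∑[ u ← U ] poorPairs (neighbours u W)
      ≡⟨ ∑-cong U (λ u → poorPairs-neighbours u W) ⟩
    ∑[ u ← U ] ∑[ v ← W ] ∑[ v′ ← W ] (ind (ρ u v ∧ ρ u v′) * ind (poor v v′))
      ≡⟨ ∑-swap U W _ ⟩
    ∑[ v ← W ] ∑[ u ← U ] ∑[ v′ ← W ] (ind (ρ u v ∧ ρ u v′) * ind (poor v v′))
      ≡⟨ ∑-cong W (λ v → ∑-swap U W _) ⟩
    ∑[ v ← W ] ∑[ v′ ← W ] ∑[ u ← U ] (ind (ρ u v ∧ ρ u v′) * ind (poor v v′))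
      ≡⟨ ∑-cong W (λ v → ∑-cong W λ v′ → ∑-*ʳ U (ind (poor v v′)) _) ⟩
    ∑[ v ← W ] ∑[ v′ ← W ] (codegree v v′ * ind (poor v v′))
      ≤⟨ ∑-mono W (λ {v} _ → ∑-mono W λ {v′} _ → bounded v v′) ⟩
    ∑[ v ← W ] ∑[ v′ ← W ] (n * ind (poor v v′))
      ≡⟨ ∑-cong W (λ v → ∑-*ˡ W n _) ⟩
    ∑[ v ← W ] (n * ∑[ v′ ← W ] ind (poor v v′))
      ≡⟨ ∑-*ˡ W n _ ⟩
    n * poorPairs W ∎
    where
    open ≤-Reasoning
    bounded : ∀ v v′ → codegree v v′ * ind (poor v v′) ≤ n * ind (poor v v′)
    bounded v v′ with codegree v v′ <ᵇ n in eq
    ... | true  = *-monoˡ-≤ 1 (<⇒≤ (<ᵇ⇒< (codegree v v′) n (≡true⇒T eq)))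
    ... | false = ≤-reflexive (trans (*-zeroʳ (codegree v v′)) (sym (*-zeroʳ n)))

  -- Dependent random choice: W′ is the common neighbourhood in W of r elements of U,
  -- chosen one at a time by averaging.
  dependent-choice : 1 ≤ length U → ∀ a r W → (∀ {v} → v ∈ W → a ≤ degree v) → Unique W →
    ∃[ W′ ] W′ ⊆ W × Unique W′ ×
      a ^ r * length W + length U ^ r * poorPairs W′ ≤ n ^ r * poorPairs W + length U ^ r * length W′
  dependent-choice nonempty a zero W rich uniq = W , id , uniq , ≤-reflexive (+-comm (1 * length W) _)
  dependent-choice nonempty a (suc r) W rich uniq =
    W′ , (λ v∈ → proj₁ (∈-filterᵇ⁻ (ρ u) W (proj₁ (proj₂ smaller) v∈))) , proj₁ (proj₂ (proj₂ smaller)) ,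
    +-cancel-cross (a ^ suc r * length W) (n ^ suc r * poorPairs W) (k ^ suc r * poorPairs W′) (k ^ suc r * length W′)
      (k * (n ^ r * poorPairs (neighbours u W))) (k * (a ^ r * length (neighbours u W)))
      (proj₂ (proj₂ choice)) scaled
    where
    open ≤-Reasoning
    k : ℕ
    k = length U

    pull : ∀ x y (f : A → ℕ) → ∑[ u ← U ] (x + k * (y * f u)) ≡ k * (x + y * ∑ U f)
    pull x y f = trans (∑-+ U _ _) (trans (cong₂ _+_ (∑-const U x)
      (trans (∑-*ˡ U k _) (cong (k *_) (∑-*ˡ U y f)))) (sym (*-distribˡ-+ k x _)))

    inner : a ^ suc r * length W + n ^ r * ∑[ u ← U ] poorPairs (neighbours u W) ≤
            n ^ suc r * poorPairs W + a ^ r * ∑[ u ← U ] length (neighbours u W)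
    inner = begin
      a ^ suc r * length W + n ^ r * ∑[ u ← U ] poorPairs (neighbours u W)
        ≤⟨ +-monoʳ-≤ (a ^ suc r * length W) (*-monoʳ-≤ (n ^ r) (∑-poorPairs W)) ⟩
      a ^ suc r * length W + n ^ r * (n * poorPairs W)
        ≡⟨ shuffle a (a ^ r) (length W) n (n ^ r) (poorPairs W) ⟩
      n ^ suc r * poorPairs W + a ^ r * (a * length W)
        ≤⟨ +-monoʳ-≤ (n ^ suc r * poorPairs W) (*-monoʳ-≤ (a ^ r) (∑-neighbours a W rich)) ⟩
      n ^ suc r * poorPairs W + a ^ r * ∑[ u ← U ] length (neighbours u W) ∎
      where
      shuffle : ∀ a b c d e f → a * b * c + e * (d * f) ≡ d * e * f + b * (a * c)
      shuffle = solve-∀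

    total : ∑[ u ← U ] (a ^ suc r * length W + k * (n ^ r * poorPairs (neighbours u W))) ≤
            ∑[ u ← U ] (n ^ suc r * poorPairs W + k * (a ^ r * length (neighbours u W)))
    total = subst₂ _≤_ (sym (pull (a ^ suc r * length W) (n ^ r) (λ u → poorPairs (neighbours u W))))
      (sym (pull (n ^ suc r * poorPairs W) (a ^ r) (λ u → length (neighbours u W)))) (*-monoʳ-≤ k inner)

    -- Divided by |U|^r, the invariant says that |W′| - poorPairs W′ is at least (a/|U|)^r |W| -
    -- (n/|U|)^r poorPairs W, the usual lower bound for the expectation over r random elements.
    -- Averaging the difference gives one `u` that is good for both terms.
    choice : ∃[ u ] u ∈ U ×
      a ^ suc r * length W + k * (n ^ r * poorPairs (neighbours u W)) ≤
      n ^ suc r * poorPairs W + k * (a ^ r * length (neighbours u W))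
    choice = averaging U _ _ nonempty total

    u : A
    u = proj₁ choice

    smaller : ∃[ W′ ] W′ ⊆ neighbours u W × Unique W′ ×
      a ^ r * length (neighbours u W) + k ^ r * poorPairs W′ ≤
      n ^ r * poorPairs (neighbours u W) + k ^ r * length W′
    smaller = dependent-choice nonempty a r (neighbours u W) (λ v∈ → rich (proj₁ (∈-filterᵇ⁻ (ρ u) W v∈)))
           (Unique-filterᵇ (ρ u) uniq)

    W′ : List B
    W′ = proj₁ smaller

    scaled : k * (a ^ r * length (neighbours u W)) + k ^ suc r * poorPairs W′ ≤
             k * (n ^ r * poorPairs (neighbours u W)) + k ^ suc r * length W′
    scaled = subst₂ _≤_ (expand k (a ^ r * length (neighbours u W)) (k ^ r) (poorPairs W′))
      (expand k (n ^ r * poorPairs (neighbours u W)) (k ^ r) (length W′)) (*-monoʳ-≤ k (proj₂ (proj₂ (proj₂ smaller))))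
      where
      expand : ∀ k x y z → k * (x + y * z) ≡ k * x + k * y * z
      expand = solve-∀

  clean : List B → List B
  clean W = filterᵇ (λ v → not (any (poor v) W)) W

  clean⁻ : ∀ W {v} → v ∈ clean W → v ∈ W × not (any (poor v) W) ≡ true
  clean⁻ W = ∈-filterᵇ⁻ (λ v → not (any (poor v) W)) W

  clean-codegree : ∀ {W v v′} → v ∈ clean W → v′ ∈ clean W → n ≤ codegree v v′
  clean-codegree {W} {v} {v′} v∈ v′∈ = ≮⇒≥ λ lt →
    no-poor W (proj₂ (clean⁻ W v∈)) (proj₁ (clean⁻ W v′∈)) (T⇒≡true (<⇒<ᵇ lt))
    where
    no-poor : ∀ xs → not (any (poor v) xs) ≡ true → v′ ∈ xs → poor v v′ ≢ true
    no-poor (x ∷ xs) none (here refl) p rewrite p with () ← none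
    no-poor (x ∷ xs) none (there v′∈) p with poor v x
    ... | false = no-poor xs none v′∈ p
    no-poor (x ∷ xs) () (there v′∈) p | true

  -- Each deleted vertex is the first entry of some poor pair.
  length-clean : ∀ W → length W ≤ length (clean W) + poorPairs W
  length-clean W = begin
    length W                                                  ≡⟨ trans (∑-const W 1) (*-identityʳ _) ⟨
    ∑[ _ ← W ] 1                                              ≤⟨ ∑-mono W (λ {v} _ → kept-or-poor v) ⟩
    ∑[ v ← W ] (ind (not (any (poor v) W)) + count (poor v) W) ≡⟨ ∑-+ W _ _ ⟩
    count (λ v → not (any (poor v) W)) W + poorPairs W        ≡⟨ cong (_+ poorPairs W) (length-filterᵇ _ W) ⟨
    length (clean W) + poorPairs W                            ∎
    where
    open ≤-Reasoning
    any⇒count : ∀ (p : B → Bool) xs → any p xs ≡ true → 1 ≤ count p xs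
    any⇒count p (x ∷ xs) eq with p x
    ... | true  = s≤s z≤n
    ... | false = any⇒count p xs eq
    kept-or-poor : ∀ v → 1 ≤ ind (not (any (poor v) W)) + count (poor v) W
    kept-or-poor v with any (poor v) W in eq
    ... | true  = any⇒count (poor v) W eq
    ... | false = s≤s z≤n

-- Call a vertex of V rich if it has at least |U|/d neighbours in U. In the size of V, the factor d
-- pays for keeping only the rich vertices, d^r for the r choices, and 2 for deleting poor pairs. A
-- vertex survives the choices with weight d^-r, a poor pair with at most (dm)^-r; since a rich
-- vertex is in at most |V| poor pairs, `large` makes these cost at most half.
module Dichotomy {A B : Set} (ρ : A → B → Bool) (d n m r : ℕ) (1≤d : 1 ≤ d) (1≤n : 1 ≤ n) (1≤m : 1 ≤ m)
  (U : List A) (|U| : length U ≡ d * (n * m))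
  (V : List B) (uniqV : Unique V) (|V| : length V ≡ 2 * d * d ^ r * length U)
  (large : 2 * length V ≤ m ^ r)
  where

  open DependentChoice ρ n U

  rich : B → Bool
  rich v = n * m ≤ᵇ degree v

  richOnes : List B
  richOnes = filterᵇ rich V

  1≤|U| : 1 ≤ length U
  1≤|U| = subst (1 ≤_) (sym |U|) (*-mono-≤ 1≤d (*-mono-≤ 1≤n 1≤m))

  dense : length V ≤ d * length richOnes →
          ∃[ W ] W ⊆ V × Unique W × length W ≡ length U × (∀ {v v′} → v ∈ W → v′ ∈ W → n ≤ codegree v v′)
  dense |V|≤dw =
    take u (clean W′) , (λ v∈ → proj₁ (∈-filterᵇ⁻ rich V (proj₁ (proj₂ choice) (proj₁ (clean⁻ W′ (⊆clean v∈)))))) ,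
    Unique.take⁺ u (Unique-filterᵇ _ (proj₁ (proj₂ (proj₂ choice)))) , length-take-≤ u (clean W′) enough ,
    λ v∈ v′∈ → clean-codegree {W′} (⊆clean v∈) (⊆clean v′∈)
    where
    open ≤-Reasoning
    choice : ∃[ W′ ] W′ ⊆ richOnes × Unique W′ ×
      (n * m) ^ r * length richOnes + length U ^ r * poorPairs W′ ≤
      n ^ r * poorPairs richOnes + length U ^ r * length W′
    choice = dependent-choice 1≤|U| (n * m) r richOnes
      (λ v∈ → ≤ᵇ⇒≤ _ _ (≡true⇒T (proj₂ (∈-filterᵇ⁻ rich V v∈)))) (Unique-filterᵇ rich uniqV)

    W′ : List B
    W′ = proj₁ choice

    u w c : ℕ
    u = length U
    w = length richOnes
    c = length (clean W′)

    ⊆clean : take u (clean W′) ⊆ clean W′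
    ⊆clean = take-⊆ u (clean W′)

    nonZero-pow : ∀ {k} → 1 ≤ k → NonZero (k ^ r)
    nonZero-pow {k} 1≤k = m^n≢0 k r {{>-nonZero 1≤k}}

    n^r m^r d^r : ℕ
    n^r = n ^ r
    m^r = m ^ r
    d^r = d ^ r

    nm^r : (n * m) ^ r ≡ n^r * m^r
    nm^r = ^-distribʳ-* r n m

    u^r : u ^ r ≡ d^r * (n^r * m^r)
    u^r = trans (cong (_^ r) |U|) (trans (^-distribʳ-* r d (n * m)) (cong (d^r *_) nm^r))

    step₁ : (n * m) ^ r * w ≤ n^r * poorPairs richOnes + u ^ r * c
    step₁ = +-cancelʳ-≤ (u ^ r * poorPairs W′) _ _ (begin
      (n * m) ^ r * w + u ^ r * poorPairs W′                        ≤⟨ proj₂ (proj₂ (proj₂ choice)) ⟩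
      n^r * poorPairs richOnes + u ^ r * length W′                  ≤⟨ +-monoʳ-≤ (n^r * poorPairs richOnes) (*-monoʳ-≤ (u ^ r) (length-clean W′)) ⟩
      n^r * poorPairs richOnes + u ^ r * (c + poorPairs W′)         ≡⟨ expand (n^r * poorPairs richOnes) (u ^ r) c (poorPairs W′) ⟩
      n^r * poorPairs richOnes + u ^ r * c + u ^ r * poorPairs W′   ∎)
      where
      expand : ∀ x y z t → x + y * (z + t) ≡ x + y * z + y * t
      expand = solve-∀

    step₂ : m^r * w ≤ length V * w + d^r * m^r * c
    step₂ = *-cancelˡ-≤ n^r {{nonZero-pow 1≤n}} (begin
      n^r * (m^r * w)                                   ≡⟨ *-assoc n^r m^r w ⟨
      n^r * m^r * w                                     ≡⟨ cong (_* w) nm^r ⟨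
      (n * m) ^ r * w                                   ≤⟨ step₁ ⟩
      n^r * poorPairs richOnes + u ^ r * c              ≤⟨ +-mono-≤ (*-monoʳ-≤ n^r poor≤) (≤-reflexive (cong (_* c) u^r)) ⟩
      n^r * (length V * w) + d^r * (n^r * m^r) * c     ≡⟨ factor n^r (length V * w) d^r m^r c ⟩
      n^r * (length V * w + d^r * m^r * c)             ∎)
      where
      poor≤ : poorPairs richOnes ≤ length V * w
      poor≤ = ≤-trans (poorPairs≤ richOnes) (*-monoˡ-≤ w (List.length-filter (T? ∘ rich) V))
      factor : ∀ a b c d e → a * b + c * (a * d) * e ≡ a * (b + c * d * e)
      factor = solve-∀

    step₃ : w ≤ 2 * d^r * c
    -- Twice `step₂`: by `large` its first term is at most one of the two copies of `m^r * w` and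
    -- cancels.
    step₃ = *-cancelˡ-≤ m^r {{nonZero-pow 1≤m}} (+-cancelˡ-≤ (m^r * w) _ _ (begin
      m^r * w + m^r * w                              ≡⟨ double (m^r * w) ⟩
      2 * (m^r * w)                                  ≤⟨ *-monoʳ-≤ 2 step₂ ⟩
      2 * (length V * w + d^r * m^r * c)            ≡⟨ expand (length V) w d^r m^r c ⟩
      2 * length V * w + m^r * (2 * d^r * c)        ≤⟨ +-monoˡ-≤ _ (*-monoˡ-≤ w large) ⟩
      m^r * w + m^r * (2 * d^r * c)                 ∎))
      where
      double : ∀ x → x + x ≡ 2 * x
      double = solve-∀
      expand : ∀ v w a b c → 2 * (v * w + a * b * c) ≡ 2 * v * w + b * (2 * a * c)
      expand = solve-∀

    enough : u ≤ c
    enough = *-cancelˡ-≤ (2 * d * d^r) {{m*n≢0 (2 * d) d^r {{m*n≢0 2 d {{_}} {{>-nonZero 1≤d}}}} {{nonZero-pow 1≤d}}}} (begin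
      2 * d * d^r * u          ≡⟨ |V| ⟨
      length V               ≤⟨ |V|≤dw ⟩
      d * w                 ≤⟨ *-monoʳ-≤ d step₃ ⟩
      d * (2 * d^r * c)    ≡⟨ collect d d^r c ⟩
      2 * d * d^r * c          ∎)
      where
      collect : ∀ d a c → d * (2 * a * c) ≡ 2 * d * a * c
      collect = solve-∀

  -- The at most |V|/d rich vertices have degree at most |U|, all others degree below |U|/d. Each
  -- kind contributes at most |U||V|/d, hence the factor 2.
  sparse : d * length richOnes ≤ length V →
           d * ∑[ v ← V ] degree v ≤ 2 * (length U * length V)
  sparse few = (begin
    d * ∑[ v ← V ] degree v                       ≡⟨ ∑-*ˡ V d degree ⟨
    ∑[ v ← V ] (d * degree v)                     ≤⟨ ∑-mono V (λ {v} _ → split v) ⟩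
    ∑[ v ← V ] (d * length U * ind (rich v) + length U) ≡⟨ ∑-+ V _ _ ⟩
    ∑[ v ← V ] (d * length U * ind (rich v)) + ∑[ _ ← V ] length U
      ≡⟨ cong₂ _+_ (∑-*ˡ V (d * length U) _) (∑-const V (length U)) ⟩
    d * length U * count rich V + length V * length U ≡⟨ cong (λ z → d * length U * z + length V * length U) (length-filterᵇ rich V) ⟨
    d * length U * length richOnes + length V * length U ≡⟨ cong (_+ length V * length U) (commute d (length U) (length richOnes)) ⟩
    length U * (d * length richOnes) + length V * length U ≤⟨ +-monoˡ-≤ _ (*-monoʳ-≤ (length U) few) ⟩
    length U * length V + length V * length U      ≡⟨ double (length U) (length V) ⟩
    2 * (length U * length V)                      ∎)
    where
    open ≤-Reasoning
    commute : ∀ d a b → d * a * b ≡ a * (d * b)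
    commute = solve-∀
    double : ∀ a b → a * b + b * a ≡ 2 * (a * b)
    double = solve-∀
    split : ∀ v → d * degree v ≤ d * length U * ind (rich v) + length U
    split v with n * m ≤ᵇ degree v in eq
    ... | true  = ≤-trans (≤-trans (*-monoʳ-≤ d {degree v} {length U} (count≤length _ U)) (≤-reflexive (sym (*-identityʳ _)))) (m≤m+n _ _)
    ... | false = ≤-trans (≤-trans (*-monoʳ-≤ d {degree v} {n * m} (<⇒≤ (≰⇒> (λ le → case trans (sym eq) (T⇒≡true (≤⇒≤ᵇ le)) of λ ()))))
                    (≤-reflexive (sym |U|))) (m≤n+m _ (d * length U * 0))

  dichotomy : (∃[ W ] W ⊆ V × Unique W × length W ≡ length U × (∀ {v v′} → v ∈ W → v′ ∈ W → n ≤ codegree v v′))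
            ⊎ d * ∑[ v ← V ] degree v ≤ 2 * (length U * length V)
  dichotomy with ≤-total (length V) (d * length richOnes)
  ... | inj₁ le = inj₁ (dense le)
  ... | inj₂ ge = inj₂ (sparse ge)

-- From linked vertex sets to linked rows of distinct vertices.

module _ {S : Set} (_≟ₛ_ : ∀ (x y : S) → Dec (x ≡ y)) where

  pick-fresh : ∀ (xs used : List S) → Unique xs → length used < length xs → ∃[ x ] x ∈ xs × x ∉ used
  pick-fresh xs used uniq lt with Any.any? (λ x → ¬? (Any.any? (x ≟ₛ_) used)) xs
  ... | yes found = find found
  ... | no none = contradiction (Unique-⊆⇒length≤ uniq (λ {x} x∈ → decidable-stable (Any.any? (x ≟ₛ_) used)
                    (λ x∉ → none (Any.map (λ { refl → x∉ }) x∈)))) (<⇒≱ lt)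

  -- Greedy choice instead of Hall's condition: every list is longer than everything chosen or
  -- excluded so far.
  distinct-representatives : ∀ k (cand : Fin k → List S) (used : List S) → (∀ i → Unique (cand i)) →
    (∀ i → length used + k ≤ length (cand i)) →
    Σ[ g ∈ (Fin k → S) ] (∀ i → g i ∈ cand i) × (∀ i → g i ∉ used) × (∀ {i j} → g i ≡ g j → i ≡ j)
  distinct-representatives zero cand used uniq enough = (λ ()) , (λ ()) , (λ ()) , λ { {()} }
  distinct-representatives (suc k) cand used uniq enough = g , g∈ , g∉ , g-inj
    where
    first : ∃[ x ] x ∈ cand Fin.zero × x ∉ used
    first = pick-fresh _ used (uniq Fin.zero)
      (<-≤-trans (≤-trans (s≤s (m≤m+n _ k)) (≤-reflexive (sym (+-suc (length used) k)))) (enough Fin.zero))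

    x : S
    x = proj₁ first

    rest : Σ[ g ∈ (Fin k → S) ] (∀ i → g i ∈ cand (Fin.suc i)) × (∀ i → g i ∉ x ∷ used) × (∀ {i j} → g i ≡ g j → i ≡ j)
    rest = distinct-representatives k (cand ∘ Fin.suc) (x ∷ used) (uniq ∘ Fin.suc)
      (λ i → ≤-trans (≤-reflexive (sym (+-suc (length used) k))) (enough (Fin.suc i)))

    g : Fin (suc k) → S
    g Fin.zero    = x
    g (Fin.suc i) = proj₁ rest i

    g∈ : ∀ i → g i ∈ cand i
    g∈ Fin.zero    = proj₁ (proj₂ first)
    g∈ (Fin.suc i) = proj₁ (proj₂ rest) i

    g∉ : ∀ i → g i ∉ used
    g∉ Fin.zero    = proj₂ (proj₂ first)
    g∉ (Fin.suc i) = proj₁ (proj₂ (proj₂ rest)) i ∘ there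

    g-inj : ∀ {i j} → g i ≡ g j → i ≡ j
    g-inj {Fin.zero}  {Fin.zero}  _  = refl
    g-inj {Fin.zero}  {Fin.suc j} eq = contradiction (here (sym eq)) (proj₁ (proj₂ (proj₂ rest)) j)
    g-inj {Fin.suc i} {Fin.zero}  eq = contradiction (here eq) (proj₁ (proj₂ (proj₂ rest)) i)
    g-inj {Fin.suc i} {Fin.suc j} eq = cong Fin.suc (proj₂ (proj₂ (proj₂ rest)) eq)

-- The last index has no successor; the default `i` asks for a common neighbour of a vertex with
-- itself.
next : ∀ {n} → Fin n → Fin n
next {n} i with suc (toℕ i) <? n
... | yes lt = fromℕ< lt
... | no _   = i

next-suc : ∀ {n} (i j : Fin n) → toℕ j ≡ suc (toℕ i) → next i ≡ j
next-suc {n} i j eq with suc (toℕ i) <? n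
... | yes lt = Fin.toℕ-injective (trans (Fin.toℕ-fromℕ< lt) (sym eq))
... | no ≮   = contradiction (subst (_< n) eq (Fin.toℕ<n j)) ≮

-- The rows are the diagonals a + b = 0, 1, 2, … of the grid.
module Rows {I S : Set} (_≟ₛ_ : ∀ (x y : S) → Dec (x ≡ y))
  (Adj : I → I → Set) (E : I × S → I × S → Bool) (n : ℕ) where

  Level Row : Set
  Level = I × List S
  Row   = I × (Fin n → S)

  -- Entries fixed in the first level `W` can be continued into the second level `U`. The head of a
  -- list is thus the top of the search stack, and rows are filled from there downwards.
  LevelLink : Level → Level → Set
  LevelLink (q , W) (p , U) = Adj q p × (∀ {v v′} → v ∈ W → v′ ∈ W →
    n ≤ count (λ u → E (p , u) (q , v) ∧ E (p , u) (q , v′)) U)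

  -- A cell (a, b) will be at index `opposite a`, so the neighbours on the preceding diagonal of the
  -- cell at index i have indices i and i + 1. Every row has n entries, although most diagonals use
  -- fewer.
  RowLink : Row → Row → Set
  RowLink (q , f) (p , g) = Adj q p × (∀ {i j} → j ≡ i ⊎ toℕ j ≡ suc (toℕ i) → E (p , g i) (q , f j) ≡ true)

  InjectiveRow : Row → Set
  InjectiveRow (_ , f) = ∀ {i j} → f i ≡ f j → i ≡ j

  next-row : ∀ {q W p U} → LevelLink (q , W) (p , U) → Unique U → (f : Fin n → S) → (∀ i → f i ∈ W) →
             Σ[ g ∈ (Fin n → S) ] (∀ i → g i ∈ U) × InjectiveRow (p , g) × RowLink (q , f) (p , g)
  next-row {q} {W} {p} {U} (adj , codegree) uniq f f∈ =
    g , (λ i → proj₁ (cand⁻ i)) , proj₂ (proj₂ (proj₂ chosen)) , adj , joined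
    where
    common : Fin n → S → Bool
    common i u = E (p , u) (q , f i) ∧ E (p , u) (q , f (next i))

    chosen : Σ[ g ∈ (Fin n → S) ] (∀ i → g i ∈ filterᵇ (common i) U) × (∀ i → g i ∉ []) × (∀ {i j} → g i ≡ g j → i ≡ j)
    chosen = distinct-representatives _≟ₛ_ n (λ i → filterᵇ (common i) U) []
      (λ i → Unique-filterᵇ (common i) uniq)
      (λ i → ≤-trans (codegree (f∈ i) (f∈ (next i))) (≤-reflexive (sym (length-filterᵇ (common i) U))))

    g : Fin n → S
    g = proj₁ chosen

    cand⁻ : ∀ i → g i ∈ U × common i (g i) ≡ true
    cand⁻ i = ∈-filterᵇ⁻ (common i) U (proj₁ (proj₂ chosen) i)

    joined : ∀ {i j} → j ≡ i ⊎ toℕ j ≡ suc (toℕ i) → E (p , g i) (q , f j) ≡ true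
    joined {i} (inj₁ refl) = proj₁ (∧-true (proj₂ (cand⁻ i)))
    joined {i} {j} (inj₂ eq) = subst (λ k → E (p , g i) (q , f k) ≡ true) (next-suc i j eq)
      (proj₂ (∧-true {E (p , g i) (q , f i)} (proj₂ (cand⁻ i))))

  rows-from : ∀ q W levels → Linked LevelLink ((q , W) ∷ levels) → All (Unique ∘ proj₂) levels →
              (f : Fin n → S) → (∀ i → f i ∈ W) → InjectiveRow (q , f) →
              ∃[ rows ] Linked RowLink ((q , f) ∷ rows) × All InjectiveRow rows × map proj₁ rows ≡ map proj₁ levels
  rows-from q W [] _ _ f f∈ f-inj = [] , [-] , [] , refl
  rows-from q W ((p , U) ∷ levels) (link ∷ links) (uniq ∷ uniqs) f f∈ f-inj
    with next-row link uniq f f∈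
  ... | g , g∈ , g-inj , row-link with rows-from p U levels links uniqs g g∈ g-inj
  ...   | rows , row-links , injs , eq = (p , g) ∷ rows , row-link ∷ row-links , g-inj ∷ injs , cong (p ∷_) eq

  rows : ∀ levels → Linked LevelLink levels → All (Unique ∘ proj₂) levels → All (λ l → n ≤ length (proj₂ l)) levels →
         ∃[ rows ] Linked RowLink rows × All InjectiveRow rows × map proj₁ rows ≡ map proj₁ levels
  rows [] _ _ _ = [] , [] , [] , refl
  rows ((q , W) ∷ levels) links (uniq ∷ uniqs) (n≤ ∷ _)
    with distinct-representatives _≟ₛ_ n (λ _ → W) [] (λ _ → uniq) (λ _ → n≤)
  ... | f , f∈ , _ , f-inj with rows-from q W levels links uniqs f f∈ f-inj
  ...   | rs , row-links , injs , eq = (q , f) ∷ rs , row-links , f-inj ∷ injs , cong (q ∷_) eq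

Linked-lookup : ∀ {A : Set} {R : A → A → Set} {xs} → Linked R xs → (i j : Fin (length xs)) →
                toℕ j ≡ suc (toℕ i) → R (List.lookup xs i) (List.lookup xs j)
Linked-lookup (r ∷ _)  Fin.zero    (Fin.suc Fin.zero) _  = r
Linked-lookup (_ ∷ rs) (Fin.suc i) (Fin.suc j)        eq = Linked-lookup rs i j (suc-injective eq)

Unique-map-lookup : ∀ {A B : Set} (f : A → B) {xs} → Unique (map f xs) → (i j : Fin (length xs)) →
                    f (List.lookup xs i) ≡ f (List.lookup xs j) → i ≡ j
Unique-map-lookup f {_ ∷ _}  _          Fin.zero    Fin.zero    _  = refl
Unique-map-lookup f {_ ∷ xs} (x# ∷ _)   Fin.zero    (Fin.suc j) eq = contradiction eq (All.lookup x# (∈-map⁺ f (∈-lookup j)))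
Unique-map-lookup f {_ ∷ xs} (x# ∷ _)   (Fin.suc i) Fin.zero    eq = contradiction (sym eq) (All.lookup x# (∈-map⁺ f (∈-lookup i)))
Unique-map-lookup f {_ ∷ xs} (_ ∷ uniq) (Fin.suc i) (Fin.suc j) eq = cong Fin.suc (Unique-map-lookup f uniq i j eq)

-- Colourings of a blow-up, and grid copies from rows.

-- Computes to `b` or `not b` once the colour is known, so codegrees counted with ρ or with its
-- negation fit `LevelLink` without rewriting.
Agree : Bool → Bool → Bool
Agree true  b = b
Agree false b = not b

Agree⇒≡ : ∀ c b → Agree c b ≡ true → b ≡ c
Agree⇒≡ true  true  _ = refl
Agree⇒≡ false false _ = refl

∣-∣≡1 : ∀ m n → ∣ m - n ∣ ≡ 1 → n ≡ suc m ⊎ m ≡ suc n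
∣-∣≡1 zero    (suc zero) _  = inj₁ refl
∣-∣≡1 (suc m) zero       eq = inj₂ eq
∣-∣≡1 (suc m) (suc n)    eq = [ inj₁ ∘ cong suc , inj₂ ∘ cong suc ]′ (∣-∣≡1 m n eq)

module Total {G : Graph} (χ : Colouring G) where

  open Graph G
  open Colouring χ

  -- Non-edges get `false`, which is also the blue colour. The colour alone therefore never
  -- certifies an edge, and links carry `Adj` beside it.
  colourOf : Vertex → Vertex → Bool
  colourOf u v with u ∼? v
  ... | yes p = colour {u} {v} p
  ... | no _  = false

  colourOf-∼ : ∀ u v (p : u ∼ v) → colour {u} {v} p ≡ colourOf u v
  colourOf-∼ u v p with u ∼? v
  -- Two proofs of u ∼ v are compared through a proof of v ∼ u.
  ... | yes q = trans (colour-sym {u} {v} p (∼-sym q)) (sym (colour-sym {u} {v} q (∼-sym q)))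
  ... | no ¬q = contradiction p ¬q

  colourOf-sym : ∀ u v → colourOf u v ≡ colourOf v u
  colourOf-sym u v with u ∼? v | v ∼? u
  ... | yes p | yes q = colour-sym {u} {v} p q
  ... | yes p | no ¬q = contradiction (∼-sym p) ¬q
  ... | no ¬p | yes q = contradiction (∼-sym q) ¬p
  ... | no _  | no _  = refl

from-injective : ∀ {A B : Set} (A↔B : A ↔ B) {x y} → Inverse.from A↔B x ≡ Inverse.from A↔B y → x ≡ y
from-injective A↔B {x} {y} eq = trans (sym (Inverse.strictlyInverseˡ A↔B x))
  (trans (cong (Inverse.to A↔B) eq) (Inverse.strictlyInverseˡ A↔B y))

∈-edges⁻ : ∀ (G : Graph) {i j} → (i , j) ∈ Graph.edges G → i Fin.< j × Graph._∼_ G (Graph.vertex G i) (Graph.vertex G j)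
∈-edges⁻ G ij∈ = proj₂ (∈-filter⁻ _ {xs = cartesianProduct (allFin (Graph.order G)) (allFin (Graph.order G))} ij∈)

Unique-edges : ∀ (G : Graph) → Unique (Graph.edges G)
Unique-edges G = Unique.filter⁺ _ (Unique.cartesianProduct⁺ (Unique.allFin⁺ (Graph.order G)) (Unique.allFin⁺ (Graph.order G)))

module Blowup (N s : ℕ) (Adj : Fin N → Fin N → Set) (Adj? : ∀ i j → Dec (Adj i j))
  (Adj-sym : ∀ {i j} → Adj i j → Adj j i) (Adj-irrefl : ∀ {i} → ¬ Adj i i) where

  blowup : Graph
  blowup = record
    { Vertex   = Fin N × Fin s
    ; order    = N * s
    ; vertices = ↔-sym Fin.*↔×
    ; _∼_      = λ u v → Adj (proj₁ u) (proj₁ v)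
    ; _∼?_     = λ u v → Adj? (proj₁ u) (proj₁ v)
    ; ∼-sym    = Adj-sym
    ; ∼-irrefl = λ { refl → Adj-irrefl }
    }

  open Graph blowup using (Vertex; order; vertex; vertices; edges; e; _∼_; _∼?_)

  -- The order of the endpoints in `edges` need not match the order in `hs`; counting both
  -- orientations gives the factor 2.
  e-blowup≤ : ∀ (hs : List (Fin N × Fin N)) → (∀ {i j} → Adj i j → (i , j) ∈ hs ⊎ (j , i) ∈ hs) →
              e ≤ 2 * length hs * (s * s)
  e-blowup≤ hs listed = begin
    length edges               ≡⟨ List.length-map endpoints edges ⟨
    length (map endpoints edges) ≤⟨ Unique-⊆⇒length≤ (Unique.map⁺ endpoints-injective (Unique-edges blowup)) covered ⟩
    length cover               ≡⟨ trans (length-productWith lift (hs ++ map swap hs) _)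
                                  (cong₂ _*_ |2hs| (trans (length-productWith _,_ (allFin s) (allFin s)) (cong₂ _*_ (length-allFin s) (length-allFin s)))) ⟩
    2 * length hs * (s * s)    ∎
    where
    open ≤-Reasoning
    endpoints : Fin order × Fin order → Vertex × Vertex
    endpoints (i , j) = vertex i , vertex j

    endpoints-injective : ∀ {x y} → endpoints x ≡ endpoints y → x ≡ y
    endpoints-injective eq = cong₂ _,_ (from-injective vertices (cong proj₁ eq)) (from-injective vertices (cong proj₂ eq))

    lift : Fin N × Fin N → Fin s × Fin s → Vertex × Vertex
    lift (p , q) (x , y) = (p , x) , (q , y)

    cover : List (Vertex × Vertex)
    cover = cartesianProductWith lift (hs ++ map swap hs) (cartesianProduct (allFin s) (allFin s))

    |2hs| : length (hs ++ map swap hs) ≡ 2 * length hs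
    |2hs| = trans (List.length-++ hs) (cong (length hs +_) (trans (List.length-map swap hs) (sym (+-identityʳ _))))

    covered : map endpoints edges ⊆ cover
    covered z∈ with ∈-map⁻ endpoints z∈
    ... | (i , j) , ij∈ , refl = ∈-cartesianProductWith⁺ lift
      ([ ∈-++⁺ˡ , (λ ∈hs → ∈-++⁺ʳ hs (∈-map⁺ swap ∈hs)) ]′ (listed (proj₂ (∈-edges⁻ blowup ij∈))))
      (∈-cartesianProduct⁺ (∈-allFin (proj₂ (vertex i))) (∈-allFin (proj₂ (vertex j))))

  module _ (χ : Colouring blowup) where

    open Colouring χ
    open Total χ

    module _ (n : ℕ) (c : Bool) where

      open Rows Fin._≟_ Adj (λ u v → Agree c (colourOf u v)) (suc n)

      -- Cell (a, b) goes to row a + b, entry `opposite a`. Different rows lie in different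
      -- clusters, so the image determines a + b, and injectivity of the row then gives a.
      rows⇒copy : ∀ rs → Linked RowLink rs → All InjectiveRow rs → Unique (map proj₁ rs) →
                  suc (n + n) ≤ length rs →
                  Σ[ φ ∈ Copy (grid (suc n) (suc n)) blowup ] Monochromatic χ φ
      rows⇒copy rs links injs uniq long = φ , c , mono
        where
        Cell : Set
        Cell = Fin (suc n) × Fin (suc n)

        diagonal< : ∀ (x : Cell) → toℕ (proj₁ x) + toℕ (proj₂ x) < length rs
        diagonal< (a , b) = <-≤-trans (s≤s (+-mono-≤ (Fin.toℕ≤pred[n] a) (Fin.toℕ≤pred[n] b))) long

        diagonal : Cell → Fin (length rs)
        diagonal x = fromℕ< (diagonal< x)

        row : Cell → Row
        row x = List.lookup rs (diagonal x)

        φ-embed : Cell → Vertex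
        φ-embed x = proj₁ (row x) , proj₂ (row x) (opposite (proj₁ x))

        same-row : ∀ r r′ → r ≡ r′ → InjectiveRow r → ∀ {i j} → proj₂ r i ≡ proj₂ r′ j → i ≡ j
        same-row r .r refl inj = inj

        φ-injective : ∀ {x y} → φ-embed x ≡ φ-embed y → x ≡ y
        φ-injective {x@(a , b)} {y@(a′ , b′)} eq = cong₂ _,_ a≡a′ b≡b′
          where
          rows≡ : diagonal x ≡ diagonal y
          rows≡ = Unique-map-lookup proj₁ uniq (diagonal x) (diagonal y) (cong proj₁ eq)
          opposite≡ : opposite a ≡ opposite a′
          opposite≡ = same-row (row x) (row y) (cong (List.lookup rs) rows≡)
            (All.lookup injs (∈-lookup (diagonal x))) (cong proj₂ eq)
          a≡a′ : a ≡ a′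
          a≡a′ = trans (sym (Fin.opposite-involutive a)) (trans (cong opposite opposite≡) (Fin.opposite-involutive a′))
          sums≡ : toℕ a + toℕ b ≡ toℕ a′ + toℕ b′
          sums≡ = trans (sym (Fin.toℕ-fromℕ< (diagonal< x))) (trans (cong toℕ rows≡) (Fin.toℕ-fromℕ< (diagonal< y)))
          b≡b′ : b ≡ b′
          b≡b′ = Fin.toℕ-injective (+-cancelˡ-≡ (toℕ a) _ _ (trans sums≡ (cong (λ z → toℕ z + toℕ b′) (sym a≡a′))))

        Up : Cell → Cell → Set
        Up (a , b) (a′ , b′) = (a ≡ a′ × toℕ b′ ≡ suc (toℕ b)) ⊎ (toℕ a′ ≡ suc (toℕ a) × b ≡ b′)

        up-diagonal : ∀ x y → Up x y → toℕ (diagonal y) ≡ suc (toℕ (diagonal x))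
        up-diagonal x@(a , b) y@(a′ , b′) up = trans (Fin.toℕ-fromℕ< (diagonal< y))
          (trans (sums up) (cong suc (sym (Fin.toℕ-fromℕ< (diagonal< x)))))
          where
          sums : Up x y → toℕ a′ + toℕ b′ ≡ suc (toℕ a + toℕ b)
          sums (inj₁ (refl , eq)) = trans (cong (toℕ a +_) eq) (+-suc (toℕ a) (toℕ b))
          sums (inj₂ (eq , refl)) = cong (_+ toℕ b) eq

        up-index : ∀ x y → Up x y → opposite (proj₁ x) ≡ opposite (proj₁ y) ⊎
                   toℕ (opposite (proj₁ x)) ≡ suc (toℕ (opposite (proj₁ y)))
        up-index x y (inj₁ (refl , _)) = inj₁ refl
        up-index (a , b) (a′ , b′) (inj₂ (eq , _)) = inj₂ (trans (Fin.opposite-prop a)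
          (trans (+-∸-assoc 1 {n} {suc (toℕ a)} a<n) (cong suc (sym (trans (Fin.opposite-prop a′) (cong (n ∸_) eq))))))
          where
          a<n : toℕ a < n
          a<n = ≤-pred (subst (_< suc n) eq (Fin.toℕ<n a′))

        up-link : ∀ x y → Up x y → RowLink (row x) (row y)
        up-link x y up = Linked-lookup links (diagonal x) (diagonal y) (up-diagonal x y up)

        up-adj : ∀ x y → Up x y → φ-embed x ∼ φ-embed y
        up-adj x y up = proj₁ (up-link x y up)

        up-colour : ∀ x y → Up x y → colourOf (φ-embed y) (φ-embed x) ≡ c
        up-colour x y up = Agree⇒≡ c _ (proj₂ (up-link x y up) (up-index x y up))

        direction : ∀ x y → Graph._∼_ (grid (suc n) (suc n)) x y → Up x y ⊎ Up y x
        direction x y (inj₁ (refl , d)) with ∣-∣≡1 _ _ d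
        ... | inj₁ eq = inj₁ (inj₁ (refl , eq))
        ... | inj₂ eq = inj₂ (inj₁ (refl , eq))
        direction x y (inj₂ (d , refl)) with ∣-∣≡1 _ _ d
        ... | inj₁ eq = inj₁ (inj₂ (eq , refl))
        ... | inj₂ eq = inj₂ (inj₂ (eq , refl))

        φ : Copy (grid (suc n) (suc n)) blowup
        φ = record
          { embed     = φ-embed
          ; injective = φ-injective
          ; edge      = λ {x} {y} x∼y → [ up-adj x y , Adj-sym ∘ up-adj y x ]′ (direction x y x∼y)
          }

        mono : ∀ {x y} (x∼y : Graph._∼_ (grid (suc n) (suc n)) x y) → colour {φ-embed x} {φ-embed y} (Copy.edge φ {x} {y} x∼y) ≡ c
        mono {x} {y} x∼y = trans (colourOf-∼ (φ-embed x) (φ-embed y) (Copy.edge φ {x} {y} x∼y))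
          ([ (λ up → trans (colourOf-sym (φ-embed x) (φ-embed y)) (up-colour x y up)) , up-colour y x ]′ (direction x y x∼y))

-- Tools for the blue case: sparse pairs and a balanced search.

Unique-resp-↭ : ∀ {A : Set} {xs ys : List A} → xs ↭ ys → Unique xs → Unique ys
Unique-resp-↭ {A} perm = ↭ₛ.Unique-resp-↭ (setoid A) (↭⇒↭ₛ perm)

Unique-++⁻ˡ : ∀ {A : Set} (xs : List A) {ys} → Unique (xs ++ ys) → Unique xs
Unique-++⁻ˡ []       _           = []
Unique-++⁻ˡ (x ∷ xs) (x# ∷ uniq) = All.++⁻ˡ xs x# ∷ Unique-++⁻ˡ xs uniq

Unique-++⁻ʳ : ∀ {A : Set} (xs : List A) {ys} → Unique (xs ++ ys) → Unique ys
Unique-++⁻ʳ []       uniq       = uniq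
Unique-++⁻ʳ (x ∷ xs) (_ ∷ uniq) = Unique-++⁻ʳ xs uniq

Unique-++⇒≢ : ∀ {A : Set} (xs : List A) {ys x y} → Unique (xs ++ ys) → x ∈ xs → y ∈ ys → x ≢ y
Unique-++⇒≢ (x ∷ xs) (x# ∷ _)    (here refl) y∈ = All.lookup x# (∈-++⁺ʳ xs y∈)
Unique-++⇒≢ (x ∷ xs) (_ ∷ uniq) (there x∈)  y∈ = Unique-++⇒≢ xs uniq x∈ y∈

Unique-map-filterᵇ : ∀ {A B : Set} (f : A → B) (p : A → Bool) {xs} →
                     Unique (map f xs) → Unique (map f (filterᵇ p xs))
Unique-map-filterᵇ f p uniq = AllPairs.map⁺ (AllPairs.filter⁺ (T? ∘ p) (AllPairs.map⁻ uniq))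

-- If ρ is sparse, its complement needs no choice: a typical vertex of X′ is joined to most
-- of Y, so two typical vertices have many common neighbours there.
module Halving {A B : Set} (ρ : A → B → Bool) (d : ℕ) (32≤d : 32 ≤ d)
  (X : List A) (p : A → Bool) (half : length X ≤ 2 * length (filterᵇ p X)) (1≤|X| : 1 ≤ length X)
  (X′ : List B)
  (sparse : d * ∑[ v ← X′ ] count (λ u → ρ u v) X ≤ 2 * (length X * length X′))
  where

  Y : List A
  Y = filterᵇ p X

  degree : B → ℕ
  degree v = count (λ u → ρ u v) Y

  good : B → Bool
  -- A quarter, so that two good vertices together spoil at most half of `Y`.
  good v = 4 * degree v ≤ᵇ length Y

  degree≤ : ∀ v → degree v ≤ count (λ u → ρ u v) X
  degree≤ v = ≤-trans (≤-reflexive (∑-filter p X _)) (∑-mono X λ {u} _ →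
    ≤-trans (*-monoˡ-≤ (ind (ρ u v)) (ind≤1 (p u))) (≤-reflexive (*-identityˡ _)))

  1≤|Y| : 1 ≤ length Y
  1≤|Y| = n≢0⇒n>0 λ |Y|≡0 → <⇒≱ 1≤|X| (≤-trans half (≤-reflexive (cong (2 *_) |Y|≡0)))

  bad : ℕ
  bad = count (not ∘ good) X′

  bad≤ : length Y * bad ≤ 4 * ∑[ v ← X′ ] degree v
  bad≤ = begin
    length Y * bad                              ≡⟨ ∑-*ˡ X′ (length Y) _ ⟨
    ∑[ v ← X′ ] (length Y * ind (not (good v))) ≤⟨ ∑-mono X′ (λ {v} _ → bound v) ⟩
    ∑[ v ← X′ ] (4 * degree v)                  ≡⟨ ∑-*ˡ X′ 4 degree ⟩
    4 * ∑[ v ← X′ ] degree v                    ∎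
    where
    open ≤-Reasoning
    bound : ∀ v → length Y * ind (not (good v)) ≤ 4 * degree v
    bound v with 4 * degree v ≤ᵇ length Y in eq
    ... | true  = ≤-trans (≤-reflexive (*-zeroʳ (length Y))) z≤n
    ... | false = ≤-trans (≤-reflexive (*-identityʳ (length Y)))
                    (<⇒≤ (≰⇒> λ le → case trans (sym eq) (T⇒≡true (≤⇒≤ᵇ le)) of λ ()))

  -- Here 32 = 4 · 2 · 2 · 2: the quarter in `good`, the density 2/d, the passage from X to its half
  -- Y, and the aim that at most half of X′ be bad.
  2bad≤ : 2 * bad ≤ length X′
  2bad≤ = *-cancelˡ-≤ (16 * length Y) {{m*n≢0 16 (length Y) {{_}} {{>-nonZero 1≤|Y|}}}} (begin
    16 * length Y * (2 * bad)                      ≡⟨ regroup (length Y) bad ⟩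
    32 * (length Y * bad)                          ≤⟨ *-mono-≤ 32≤d bad≤ ⟩
    d * (4 * ∑[ v ← X′ ] degree v)                 ≤⟨ *-monoʳ-≤ d (*-monoʳ-≤ 4 (∑-mono X′ λ {v} _ → degree≤ v)) ⟩
    d * (4 * ∑[ v ← X′ ] count (λ u → ρ u v) X)    ≡⟨ exchange d 4 (∑[ v ← X′ ] count (λ u → ρ u v) X) ⟩
    4 * (d * ∑[ v ← X′ ] count (λ u → ρ u v) X)    ≤⟨ *-monoʳ-≤ 4 sparse ⟩
    4 * (2 * (length X * length X′))               ≤⟨ *-monoʳ-≤ 4 (*-monoʳ-≤ 2 (*-monoˡ-≤ (length X′) half)) ⟩
    4 * (2 * (2 * length Y * length X′))           ≡⟨ collect (length Y) (length X′) ⟩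
    16 * length Y * length X′                      ∎)
    where
    open ≤-Reasoning
    regroup : ∀ y b → 16 * y * (2 * b) ≡ 32 * (y * b)
    regroup = solve-∀
    exchange : ∀ a b c → a * (b * c) ≡ b * (a * c)
    exchange = solve-∀
    collect : ∀ y x → 4 * (2 * (2 * y * x)) ≡ 16 * y * x
    collect = solve-∀

  half′ : length X′ ≤ 2 * length (filterᵇ good X′)
  half′ = +-cancelʳ-≤ (length X′) _ _ (begin
    length X′ + length X′                         ≡⟨ double (length X′) ⟩
    2 * length X′                                 ≡⟨ cong (2 *_) (count-not good X′) ⟨
    2 * (count good X′ + bad)                     ≡⟨ *-distribˡ-+ 2 (count good X′) bad ⟩
    2 * count good X′ + 2 * bad                   ≤⟨ +-mono-≤ (≤-reflexive (cong (2 *_) (sym (length-filterᵇ good X′)))) 2bad≤ ⟩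
    2 * length (filterᵇ good X′) + length X′      ∎)
    where
    open ≤-Reasoning
    double : ∀ x → x + x ≡ 2 * x
    double = solve-∀

  codegree : B → B → ℕ
  codegree v v′ = count (λ u → not (ρ u v) ∧ not (ρ u v′)) Y

  codegree≥ : ∀ {v v′} → v ∈ filterᵇ good X′ → v′ ∈ filterᵇ good X′ → length X ≤ 4 * codegree v v′
  codegree≥ {v} {v′} v∈ v′∈ = begin
    length X              ≤⟨ half ⟩
    2 * length Y          ≤⟨ *-monoʳ-≤ 2 |Y|≤ ⟩
    2 * (2 * codegree v v′) ≡⟨ *-assoc 2 2 (codegree v v′) ⟨
    4 * codegree v v′     ∎
    where
    open ≤-Reasoning
    low : ∀ {w} → w ∈ filterᵇ good X′ → 4 * degree w ≤ length Y
    low w∈ = ≤ᵇ⇒≤ _ _ (≡true⇒T (proj₂ (∈-filterᵇ⁻ good X′ w∈)))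
    cover : length Y ≤ codegree v v′ + (degree v + degree v′)
    cover = begin
      length Y                                           ≡⟨ trans (∑-const Y 1) (*-identityʳ _) ⟨
      ∑[ _ ← Y ] 1                                       ≤⟨ ∑-mono Y (λ {u} _ → one (ρ u v) (ρ u v′)) ⟩
      ∑[ u ← Y ] (ind (not (ρ u v) ∧ not (ρ u v′)) + (ind (ρ u v) + ind (ρ u v′))) ≡⟨ ∑-+ Y _ _ ⟩
      codegree v v′ + ∑[ u ← Y ] (ind (ρ u v) + ind (ρ u v′)) ≡⟨ cong (codegree v v′ +_) (∑-+ Y _ _) ⟩
      codegree v v′ + (degree v + degree v′)             ∎
      where
      one : ∀ a b → 1 ≤ ind (not a ∧ not b) + (ind a + ind b)
      one true  _     = s≤s z≤n
      one false true  = s≤s z≤n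
      one false false = s≤s z≤n
    |Y|≤ : length Y ≤ 2 * codegree v v′
    |Y|≤ = *-cancelˡ-≤ 2 (+-cancelʳ-≤ (length Y + length Y) _ _ (begin
      2 * length Y + (length Y + length Y)                ≡⟨ double (length Y) ⟩
      4 * length Y                                        ≤⟨ *-monoʳ-≤ 4 cover ⟩
      4 * (codegree v v′ + (degree v + degree v′))        ≡⟨ expand (codegree v v′) (degree v) (degree v′) ⟩
      2 * (2 * codegree v v′) + (4 * degree v + 4 * degree v′) ≤⟨ +-monoʳ-≤ (2 * (2 * codegree v v′)) (+-mono-≤ (low v∈) (low v′∈)) ⟩
      2 * (2 * codegree v v′) + (length Y + length Y)     ∎))
      where
      double : ∀ y → 2 * y + (y + y) ≡ 4 * y
      double = solve-∀
      expand : ∀ c a b → 4 * (c + (a + b)) ≡ 2 * (2 * c) + (4 * a + 4 * b)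
      expand = solve-∀

third-large : ∀ l x y z → x < l → y < l → 3 * l ≤ x + (y + z) → l ≤ z
third-large l x y z x<l y<l 3l≤ = ≮⇒≥ λ z<l → <⇒≱
  (<-≤-trans (+-mono-< x<l (+-mono-< y<l z<l)) (≤-reflexive (cong (λ t → l + (l + t)) (sym (+-identityʳ l))))) 3l≤

-- aᵢ and bᵢ count the two sides of a bipartition among the stack, the exhausted and the
-- unvisited vertices of a search.
balance : ∀ l a₁ a₂ a₃ b₁ b₂ b₃ → a₁ < l → b₁ < l → a₂ + b₂ ≡ 2 * l →
          3 * l ≤ a₁ + (a₂ + a₃) → 3 * l ≤ b₁ + (b₂ + b₃) →
          (l ≤ a₂ × l ≤ b₃) ⊎ (l ≤ b₂ × l ≤ a₃)
balance l a₁ a₂ a₃ b₁ b₂ b₃ a₁<l b₁<l 2l 3l≤a 3l≤b with <-≤-connex a₂ l | <-≤-connex b₃ l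
... | inj₁ a₂<l | _ = inj₂
  ( ≮⇒≥ (λ b₂<l → <-irrefl 2l (<-≤-trans (+-mono-< a₂<l b₂<l) (≤-reflexive (cong (l +_) (sym (+-identityʳ l))))))
  , third-large l a₁ a₂ a₃ a₁<l a₂<l 3l≤a)
... | inj₂ l≤a₂ | inj₂ l≤b₃ = inj₁ (l≤a₂ , l≤b₃)
... | inj₂ l≤a₂ | inj₁ b₃<l = contradiction 3l≤b (<⇒≱ (<-≤-trans
  (+-mono-<-≤ b₁<l (≤-trans (+-mono-≤ b₂≤l (<⇒≤ b₃<l)) ≤-refl)) (≤-reflexive (cong (λ t → l + (l + t)) (sym (+-identityʳ l))))))
  where
  b₂≤l : b₂ ≤ l
  b₂≤l = +-cancelˡ-≤ l _ _ (≤-trans (+-monoˡ-≤ b₂ l≤a₂) (≤-reflexive (trans 2l (cong (l +_) (+-identityʳ l)))))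

-- The blow-up arrows the grid.

module Ramsey (n d r m u₀ s L N : ℕ) (32≤d : 32 ≤ d) (1≤m : 1 ≤ m)
  (u₀≡ : u₀ ≡ d * (suc n * m)) (s≡ : s ≡ 2 * d * d ^ r * u₀) (large : 2 * s ≤ m ^ r)
  (L≡ : L ≡ suc (n + n)) (N≡ : N ≡ 7 * L)
  (hs : List (Fin N × Fin N))
  (joins : ∀ xs ys → Unique xs → Unique ys → L ≤ length xs → L ≤ length ys →
           ∃₂ λ x y → x ∈ xs × y ∈ ys × (x , y) ∈ hs)
  where

  -- The hitting set may contain pairs (x, x); requiring i ≢ j drops these loops.
  Adj : Fin N → Fin N → Set
  Adj i j = i ≢ j × ((i , j) ∈ hs ⊎ (j , i) ∈ hs)

  Adj? : ∀ i j → Dec (Adj i j)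
  Adj? i j = ¬? (i Fin.≟ j) ×-dec (listed? (i , j) ⊎-dec listed? (j , i))
    where
    listed? : ∀ ij → Dec (ij ∈ hs)
    listed? ij = Any.any? (≡-dec Fin._≟_ Fin._≟_ ij) hs

  Adj-sym : ∀ {i j} → Adj i j → Adj j i
  Adj-sym (i≢j , inj₁ ij∈) = i≢j ∘ sym , inj₂ ij∈
  Adj-sym (i≢j , inj₂ ji∈) = i≢j ∘ sym , inj₁ ji∈

  open Blowup N s Adj Adj? Adj-sym (λ adj → proj₁ adj refl) public

  1≤d : 1 ≤ d
  1≤d = ≤-trans (s≤s z≤n) 32≤d

  everything : List (Fin s)
  everything = allFin s

  |everything| : length everything ≡ s
  |everything| = length-allFin s

  u₀≤s : u₀ ≤ s
  u₀≤s = subst (u₀ ≤_) (sym s≡) (≤-trans (≤-reflexive (sym (*-identityˡ u₀)))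
    (*-monoˡ-≤ u₀ (*-mono-≤ (*-mono-≤ {1} {2} (s≤s z≤n) 1≤d) (m^n>0 d {{>-nonZero 1≤d}} r))))

  -- The factor 4 is spent in the blue case: a part is halved, and two typical vertices share half
  -- of what remains.
  4n≤u₀ : 4 * suc n ≤ u₀
  4n≤u₀ = subst (4 * suc n ≤_) (sym u₀≡) (*-mono-≤ (≤-trans (≤ᵇ⇒≤ 4 32 tt) 32≤d)
    (≤-trans (≤-reflexive (sym (*-identityʳ (suc n)))) (*-monoʳ-≤ (suc n) 1≤m)))

  n≤u₀ : suc n ≤ u₀
  n≤u₀ = ≤-trans (m≤n*m (suc n) 4) 4n≤u₀

  module _ (χ : Colouring blowup) where

    red : Fin N × Fin s → Fin N × Fin s → Bool
    red = Total.colourOf χ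

    module Chain (c : Bool) = Rows Fin._≟_ Adj (λ u v → Agree c (red u v)) (suc n)
    open Chain true using (Level; LevelLink)

    MonoGrid : Set
    MonoGrid = Σ[ φ ∈ Copy (grid (suc n) (suc n)) blowup ] Monochromatic χ φ

    levels⇒grid : ∀ c (levels : List Level) → Linked (Chain.LevelLink c) levels → All (Unique ∘ proj₂) levels →
                  All (λ l → suc n ≤ length (proj₂ l)) levels → Unique (map proj₁ levels) →
                  length levels ≡ L → MonoGrid
    levels⇒grid c levels links uniqs sizes uniq len with Chain.rows c levels links uniqs sizes
    ... | rs , row-links , injs , eq = rows⇒copy χ n c rs row-links injs (subst Unique (sym eq) uniq)
      (≤-reflexive (trans (sym L≡) (trans (sym len) (trans (sym (List.length-map proj₁ levels))
        (trans (cong length (sym eq)) (List.length-map proj₁ rs))))))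

    -- The fixed size u₀ is what lets the red path be extended any number of times with the same
    -- parameters.
    record Cluster : Set where
      constructor cluster
      field
        index   : Fin N
        members : List (Fin s)
        unique  : Unique members
        size    : length members ≡ u₀

      level : Level
      level = index , members

    open Cluster

    redEdges : Level → Level → ℕ
    redEdges (p , X) (q , Y) = ∑[ y ← Y ] count (λ x → red (p , x) (q , y)) X

    RedSparse : Level → Level → Set
    RedSparse (p , X) (q , Y) = d * redEdges (p , X) (q , Y) ≤ 2 * (length X * length Y)

    -- An alternating path enters dead clusters from fresh ones and conversely, so sparsity is
    -- needed in both directions.
    RedSparse-sym : ∀ k l → RedSparse k l → RedSparse l k
    RedSparse-sym (p , X) (q , Y) = subst₂ _≤_
      (cong (d *_) (trans (∑-swap Y X _) (∑-cong X λ x → ∑-cong Y λ y → cong ind (Total.colourOf-sym χ (p , x) (q , y)))))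
      (cong (2 *_) (*-comm (length X) (length Y)))

    RedLink : Cluster → Cluster → Set
    RedLink y x = LevelLink (level y) (level x)

    -- Non-adjacent clusters are separated vacuously. The exhausted cluster takes part with its
    -- chosen subset, the unvisited one as a whole.
    RedSep : Cluster → Fin N → Set
    RedSep x i = Adj (index x) i → RedSparse (level x) (i , everything)

    red-root : Fin N → Cluster
    red-root i = cluster i (take u₀ everything) (Unique.take⁺ u₀ (Unique.allFin⁺ s))
      (length-take-≤ u₀ everything (subst (u₀ ≤_) (sym |everything|) u₀≤s))

    red-step : ∀ x i → (∃[ y ] index y ≡ i × RedLink y x) ⊎ RedSep x i
    red-step x i = case Adj? (index x) i of λ
      { (no ¬adj) → inj₂ λ adj → contradiction adj ¬adj
      ; (yes adj) → case Dichotomy.dichotomy (λ u v → red (index x , u) (i , v)) d (suc n) m r 1≤d (s≤s z≤n) 1≤m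
                         (members x) (trans (size x) u₀≡) everything (Unique.allFin⁺ s)
                         (trans |everything| (trans s≡ (cong (2 * d * d ^ r *_) (sym (size x)))))
                         (subst (λ z → 2 * z ≤ m ^ r) (sym |everything|) large) of λ
        { (inj₁ (W , _ , uniq , |W| , codegree)) →
            inj₁ (cluster i W uniq (trans |W| (size x)) , refl , Adj-sym adj , λ {v} {v′} → codegree {v} {v′})
        ; (inj₂ sparse) → inj₂ λ _ → sparse
        }
      }

    module Red = Search index RedLink RedSep red-root (λ _ → refl) red-step

    red-chain : Red.LongChain L (allFin N) → MonoGrid
    red-chain (stack , rest , len , links , perm) = levels⇒grid true (map level stack)
      (Linked.map⁺ links)
      (All.map⁺ (All.universal unique stack))
      (All.map⁺ (All.universal (λ x → subst (suc n ≤_) (sym (size x)) n≤u₀) stack))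
      (subst Unique (List.map-∘ stack)
        (Unique-++⁻ˡ (map index stack) (Unique-resp-↭ (↭-sym perm) (Unique.allFin⁺ N))))
      (trans (List.length-map level stack) len)

    module Blue (dead : List Cluster) (fresh : List (Fin N))
      (|dead| : length dead ≡ 3 * L) (|fresh| : 3 * L ≤ length fresh)
      (uniq : Unique (map index dead ++ fresh))
      (sep : ∀ {x i} → x ∈ dead → i ∈ fresh → RedSep x i) where

      Part : Set
      Part = Cluster ⊎ Fin N

      side : Part → Level
      side (inj₁ x) = level x
      side (inj₂ i) = i , everything

      centre : Part → Fin N
      centre = proj₁ ∘ side

      isDead : Part → Bool
      isDead (inj₁ _) = true
      isDead (inj₂ _) = false

      Opposite : Part → Part → Set
      Opposite a b = isDead a ≡ not (isDead b) × Adj (centre a) (centre b)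

      Opposite? : ∀ a b → Dec (Opposite a b)
      Opposite? a b = (isDead a Bool.≟ not (isDead b)) ×-dec Adj? (centre a) (centre b)

      parts : List Part
      parts = map inj₁ dead ++ map inj₂ fresh

      inj₁∈⁻ : ∀ {x} → inj₁ x ∈ parts → x ∈ dead
      inj₁∈⁻ x∈ with ∈-++⁻ (map inj₁ dead) x∈
      ... | inj₁ x∈₁ with ∈-map⁻ inj₁ x∈₁
      ...   | _ , x∈dead , refl = x∈dead
      inj₁∈⁻ x∈ | inj₂ x∈₂ with () ← proj₂ (proj₂ (∈-map⁻ inj₂ x∈₂))

      inj₂∈⁻ : ∀ {i} → inj₂ i ∈ parts → i ∈ fresh
      inj₂∈⁻ i∈ with ∈-++⁻ (map inj₁ dead) i∈
      ... | inj₁ i∈₁ with () ← proj₂ (proj₂ (∈-map⁻ inj₁ i∈₁))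
      inj₂∈⁻ i∈ | inj₂ i∈₂ with ∈-map⁻ inj₂ i∈₂
      ... | _ , i∈fresh , refl = i∈fresh

      opposite-sparse : ∀ {a b} → a ∈ parts → b ∈ parts → Opposite a b → RedSparse (side b) (side a)
      opposite-sparse {inj₁ x} {inj₂ i} x∈ i∈ (_ , adj) =
        RedSparse-sym (side (inj₁ x)) (side (inj₂ i)) (sep (inj₁∈⁻ x∈) (inj₂∈⁻ i∈) adj)
      opposite-sparse {inj₂ i} {inj₁ x} i∈ x∈ (_ , adj) = sep (inj₁∈⁻ x∈) (inj₂∈⁻ i∈) (Adj-sym adj)

      u₀≤side : ∀ a → u₀ ≤ length (proj₂ (side a))
      u₀≤side (inj₁ x) = ≤-reflexive (sym (size x))
      u₀≤side (inj₂ i) = subst (u₀ ≤_) (sym |everything|) u₀≤s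

      4n≤side : ∀ a → 4 * suc n ≤ length (proj₂ (side a))
      4n≤side a = ≤-trans 4n≤u₀ (u₀≤side a)

      unique-side : ∀ a → Unique (proj₂ (side a))
      unique-side (inj₁ x) = unique x
      unique-side (inj₂ i) = Unique.allFin⁺ s

      half⇒n≤ : ∀ a k → length (proj₂ (side a)) ≤ 2 * k → suc n ≤ k
      half⇒n≤ a k half = *-cancelˡ-≤ 2 (≤-trans (*-monoˡ-≤ (suc n) (≤ᵇ⇒≤ 2 4 tt)) (≤-trans (4n≤side a) half))

      -- The last part stays whole; every earlier part keeps the half that is typical towards what
      -- the next part has already kept. `Halving` measures red degrees into that kept half, so
      -- earlier thinning does no further damage.
      thin : ∀ a as → (a ∷ as) ⊆ parts → Linked Opposite (a ∷ as) →
             ∃₂ λ p levels → length (proj₂ (side a)) ≤ 2 * length (filterᵇ p (proj₂ (side a))) ×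
               Linked (Chain.LevelLink false) ((centre a , filterᵇ p (proj₂ (side a))) ∷ levels) ×
               All (Unique ∘ proj₂) levels × All (λ l → suc n ≤ length (proj₂ l)) levels ×
               map proj₁ levels ≡ map centre as
      thin a [] _ _ = (λ _ → true) , [] , all-kept , [-] , [] , [] , refl
        where
        X : List (Fin s)
        X = proj₂ (side a)
        all-kept : length X ≤ 2 * length (filterᵇ (λ _ → true) X)
        all-kept = ≤-trans (≤-reflexive (sym (trans (length-filterᵇ (λ _ → true) X)
          (trans (∑-const X 1) (*-identityʳ _))))) (m≤n*m _ 2)
      thin a (b ∷ as) ⊆parts (opp ∷ links) with thin b as (⊆parts ∘ there) links
      ... | p , levels , half , level-links , uniqs , sizes , eq =
        H.good , (centre b , H.Y) ∷ levels , H.half′ , (proj₂ opp , codegree) ∷ level-links ,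
        Unique-filterᵇ p (unique-side b) ∷ uniqs , half⇒n≤ b (length H.Y) half ∷ sizes , cong (centre b ∷_) eq
        where
        module H = Halving (λ u v → red (centre b , u) (centre a , v)) d 32≤d (proj₂ (side b)) p half
          (≤-trans (s≤s z≤n) (4n≤side b)) (proj₂ (side a))
          (opposite-sparse (⊆parts (here refl)) (⊆parts (there (here refl))) opp)
        codegree : ∀ {v v′} → v ∈ filterᵇ H.good (proj₂ (side a)) → v′ ∈ filterᵇ H.good (proj₂ (side a)) →
                   suc n ≤ H.codegree v v′
        codegree v∈ v′∈ = *-cancelˡ-≤ 4 (≤-trans (4n≤side b) (H.codegree≥ v∈ v′∈))

      path-step : ∀ x i → (∃[ y ] y ≡ i × Opposite y x) ⊎ ¬ Opposite i x
      path-step x i with Opposite? i x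
      ... | yes opp = inj₁ (i , refl , opp)
      ... | no ¬opp = inj₂ ¬opp

      module Path = Search {State = Part} id Opposite (λ x i → ¬ Opposite i x) id (λ _ → refl) path-step

      unique-centres : Unique (map centre parts)
      unique-centres = subst Unique (sym (trans (List.map-++ centre (map inj₁ dead) (map inj₂ fresh))
        (cong₂ _++_ (sym (List.map-∘ dead)) (trans (sym (List.map-∘ fresh)) (List.map-id fresh))))) uniq

      unique-map-++⁻ˡ : ∀ xs {ys} → map id xs ++ ys ↭ parts → Unique (map centre xs)
      unique-map-++⁻ˡ xs perm = Unique-++⁻ˡ (map centre xs) (subst Unique
        (trans (List.map-++ centre (map id xs) _) (cong (λ zs → map centre zs ++ _) (List.map-id xs)))
        (Unique-resp-↭ (↭.map⁺ centre (↭-sym perm)) unique-centres))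

      path-grid : Path.LongChain L parts → MonoGrid
      path-grid ([] , rest , len , _) = contradiction (trans len L≡) λ ()
      path-grid (a ∷ as , rest , len , links , perm)
        with thin a as (λ {b} b∈ → ↭.∈-resp-↭ perm (∈-++⁺ˡ (subst (b ∈_) (sym (List.map-id (a ∷ as))) b∈))) links
      ... | p , levels , half , level-links , uniqs , sizes , eq =
        levels⇒grid false _ level-links (Unique-filterᵇ p (unique-side a) ∷ uniqs) (half⇒n≤ a _ half ∷ sizes)
          (subst Unique (cong (centre a ∷_) (sym eq)) (unique-map-++⁻ˡ (a ∷ as) perm))
          (trans (cong suc (trans (sym (List.length-map proj₁ levels)) (trans (cong length eq) (List.length-map centre as)))) len)

      count-isDead : count isDead parts ≡ length dead
      count-isDead = trans (∑-++ (map inj₁ dead) (map inj₂ fresh) _) (trans (cong₂ _+_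
        (trans (∑-map inj₁ dead _) (trans (∑-const dead 1) (*-identityʳ _)))
        (trans (∑-map inj₂ fresh _) (trans (∑-const fresh 0) (*-zeroʳ (length fresh)))))
        (+-identityʳ _))

      count-isFresh : count (not ∘ isDead) parts ≡ length fresh
      count-isFresh = trans (∑-++ (map inj₁ dead) (map inj₂ fresh) _) (cong₂ _+_
        (trans (∑-map inj₁ dead _) (trans (∑-const dead 0) (*-zeroʳ (length dead))))
        (trans (∑-map inj₂ fresh _) (trans (∑-const fresh 1) (*-identityʳ _))))

      -- By `balance`, L exhausted parts of one kind would face L unvisited parts of the other kind.
      -- `joins` gives an edge between them, along which the search could have continued.
      no-separation : ¬ Path.Separation L (2 * L) parts
      no-separation (stack , done , left , stack< , |done| , perm , stuck) =
        [ (λ (a , b) → crossing isDead (λ _ y p q → trans (not-true (isDead y) q) (cong not (sym p))) a b)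
        , (λ (a , b) → crossing (not ∘ isDead) (λ _ y p q → trans (sym (Bool.not-involutive (isDead y))) (trans q (sym p))) a
            (≤-trans b (∑-mono left λ {x} _ → ≤-reflexive (cong ind (sym (Bool.not-involutive (isDead x)))))))
        ]′ (balance L (count isDead stack) (count isDead done) (count isDead left)
              (count (not ∘ isDead) stack) (count (not ∘ isDead) done) (count (not ∘ isDead) left)
              (≤-<-trans (count≤length isDead stack) stack<)
              (≤-<-trans (count≤length (not ∘ isDead) stack) stack<)
              (trans (count-not isDead done) |done|)
              (≤-reflexive (trans (sym |dead|) (trans (sym count-isDead) (total isDead))))
              (≤-trans |fresh| (≤-reflexive (trans (sym count-isFresh) (total (not ∘ isDead))))))
        where
        not-true : ∀ b → not b ≡ true → b ≡ false
        not-true false _ = refl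

        perm′ : stack ++ done ++ left ↭ parts
        perm′ = subst (_↭ parts) (cong₂ (λ xs ys → xs ++ ys ++ left) (List.map-id stack) (List.map-id done)) perm

        total : ∀ p → count p parts ≡ count p stack + (count p done + count p left)
        total p = trans (∑-↭ _ (↭-sym perm′)) (trans (∑-++ stack _ _) (cong (count p stack +_) (∑-++ done left _)))

        unique-centres′ : Unique (map centre done ++ map centre left)
        unique-centres′ = subst Unique (List.map-++ centre done left)
          (Unique-++⁻ʳ (map centre stack) (subst Unique (List.map-++ centre stack _)
            (Unique-resp-↭ (↭.map⁺ centre (↭-sym perm′)) unique-centres)))

        crossing : ∀ p → (∀ a b → p a ≡ true → not (p b) ≡ true → isDead b ≡ not (isDead a)) →
                   L ≤ count p done → L ≤ count (not ∘ p) left → ⊥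
        crossing p opposite L≤done L≤left
          with joins (map centre (filterᵇ p done)) (map centre (filterᵇ (not ∘ p) left))
                 (Unique-map-filterᵇ centre p (Unique-++⁻ˡ (map centre done) unique-centres′))
                 (Unique-map-filterᵇ centre (not ∘ p) (Unique-++⁻ʳ (map centre done) unique-centres′))
                 (≤-trans L≤done (≤-reflexive (sym (trans (List.length-map centre (filterᵇ p done)) (length-filterᵇ p done)))))
                 (≤-trans L≤left (≤-reflexive (sym (trans (List.length-map centre (filterᵇ (not ∘ p) left)) (length-filterᵇ (not ∘ p) left)))))
        ... | x , y , x∈ , y∈ , xy∈hs with ∈-map⁻ centre x∈ | ∈-map⁻ centre y∈
        ...   | a , a∈ , refl | b , b∈ , refl with ∈-filterᵇ⁻ p done a∈ | ∈-filterᵇ⁻ (not ∘ p) left b∈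
        ...     | a∈done , pa | b∈left , pb = stuck a∈done b∈left
          (opposite a b pa pb ,
           Unique-++⇒≢ (map centre done) unique-centres′ (∈-map⁺ centre a∈done) (∈-map⁺ centre b∈left) ∘ sym ,
           inj₂ xy∈hs)

      blue-grid : MonoGrid
      blue-grid = [ path-grid , ⊥-elim ∘ no-separation ]′ (Path.search parts L (2 * L) enough)
        where
        enough : 2 * (2 * L) + L ≤ length parts
        enough = begin
          2 * (2 * L) + L       ≡⟨ five L ⟩
          5 * L                 ≤⟨ *-monoˡ-≤ L (≤ᵇ⇒≤ 5 6 tt) ⟩
          6 * L                 ≡⟨ six L ⟩
          3 * L + 3 * L         ≤⟨ +-mono-≤ (≤-reflexive (sym |dead|)) |fresh| ⟩
          length dead + length fresh ≡⟨ cong₂ _+_ (List.length-map inj₁ dead) (List.length-map inj₂ fresh) ⟨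
          length (map inj₁ dead) + length (map inj₂ fresh) ≡⟨ List.length-++ (map inj₁ dead) ⟨
          length parts          ∎
          where
          open ≤-Reasoning
          five : ∀ l → 2 * (2 * l) + l ≡ 5 * l
          five = solve-∀
          six : ∀ l → 6 * l ≡ 3 * l + 3 * l
          six = solve-∀

    -- This is the origin of 7: besides 3L exhausted clusters and fewer than L on the stack, 3L
    -- unvisited ones remain. The alternating search needs 3L on each side, since fewer than L of a
    -- kind on its stack and at most L exhausted must leave L unvisited.
    separation-grid : Red.Separation L (3 * L) (allFin N) → MonoGrid
    separation-grid (stack , dead , fresh , stack< , |dead| , perm , sep) =
      Blue.blue-grid dead fresh |dead| |fresh|
        (Unique-++⁻ʳ (map index stack) (Unique-resp-↭ (↭-sym perm) (Unique.allFin⁺ N))) sep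
      where
      lengths : length stack + (3 * L + length fresh) ≡ 7 * L
      lengths = trans (cong₂ _+_ (sym (List.length-map index stack))
          (trans (cong (_+ length fresh) (trans (sym |dead|) (sym (List.length-map index dead))))
            (sym (List.length-++ (map index dead)))))
        (trans (sym (List.length-++ (map index stack)))
          (trans (↭.↭-length perm) (trans (length-allFin N) N≡)))

      |fresh| : 3 * L ≤ length fresh
      |fresh| = +-cancelˡ-≤ (4 * L) _ _ (begin
        4 * L + 3 * L                               ≡⟨ seven L ⟩
        7 * L                                       ≡⟨ lengths ⟨
        length stack + (3 * L + length fresh)       ≤⟨ +-monoˡ-≤ _ (<⇒≤ stack<) ⟩
        L + (3 * L + length fresh)                  ≡⟨ +-assoc L (3 * L) (length fresh) ⟨
        4 * L + length fresh                        ∎)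
        where
        open ≤-Reasoning
        seven : ∀ l → 4 * l + 3 * l ≡ 7 * l
        seven = solve-∀

    mono-grid : MonoGrid
    mono-grid = [ red-chain , separation-grid ]′ (Red.search (allFin N) L (3 * L) (≤-reflexive (begin-equality
      2 * (3 * L) + L     ≡⟨ seven L ⟩
      7 * L               ≡⟨ N≡ ⟨
      N                   ≡⟨ length-allFin N ⟨
      length (allFin N)   ∎)))
      where
      open ≤-Reasoning
      seven : ∀ l → 2 * (3 * l) + l ≡ 7 * l
      seven = solve-∀

  arrows : blowup ⟶ grid (suc n) (suc n)
  arrows = mono-grid

-- Deciding the arrow relation, and the minimum in the size-Ramsey number.

-- Finiteness as decidability of existence; in this form it passes to vectors, hence to matrices,
-- without enumerating them.
Searchable : Set → Set₁
Searchable A = ∀ {P : A → Set} → (∀ a → Dec (P a)) → Dec (∃ P)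

search-Bool : Searchable Bool
search-Bool P? = map′ [ (true ,_) , (false ,_) ]′
  (λ { (true , p) → inj₁ p ; (false , p) → inj₂ p }) (P? true ⊎-dec P? false)

search-Vec : ∀ {A} → Searchable A → ∀ n → Searchable (Vec A n)
search-Vec searchA zero    P? = map′ ([] ,_) (λ { ([] , p) → p }) (P? [])
search-Vec searchA (suc n) P? = map′ (λ (x , xs , p) → x ∷ xs , p) (λ { (x ∷ xs , p) → x , xs , p })
  (searchA λ x → search-Vec searchA n λ xs → P? (x ∷ xs))

search-all : ∀ {A} → Searchable A → {P : A → Set} → (∀ a → Dec (P a)) → Dec (∀ a → P a)
search-all searchA P? = map′ (λ none a → decidable-stable (P? a) (λ ¬p → none (a , ¬p)))
  (λ all (a , ¬p) → ¬p (all a)) (¬? (searchA (¬? ∘ P?)))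

least : ∀ {P : ℕ → Set} → (∀ k → Dec (P k)) → ∀ k → P k → ∃[ l ] P l × l ≤ k × (∀ j → P j → l ≤ j)
least P? k pk with P? 0
... | yes p₀ = 0 , p₀ , z≤n , λ _ _ → z≤n
least P? zero    pk | no ¬p₀ = contradiction pk ¬p₀
least P? (suc k) pk | no ¬p₀ with least (P? ∘ suc) k pk
... | l , pl , l≤k , minimal = suc l , pl , s≤s l≤k ,
  λ { zero p₀ → contradiction p₀ ¬p₀ ; (suc j) pj → s≤s (minimal j pj) }

Matrix : ℕ → Set
Matrix k = Vec (Vec Bool k) k

search-Matrix : ∀ k → Searchable (Matrix k)
search-Matrix k = search-Vec (search-Vec search-Bool k) k

entry : ∀ {k} → Matrix k → Fin k → Fin k → Bool
entry m i j = Vec.lookup (Vec.lookup m i) j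

matrix : ∀ {k} → (Fin k → Fin k → Bool) → Matrix k
matrix f = Vec.tabulate λ i → Vec.tabulate (f i)

entry-matrix : ∀ {k} (f : Fin k → Fin k → Bool) i j → entry (matrix f) i j ≡ f i j
entry-matrix f i j = trans (cong (λ v → Vec.lookup v j) (Vec.lookup∘tabulate (λ i → Vec.tabulate (f i)) i))
  (Vec.lookup∘tabulate (f i) j)

-- Every Boolean matrix is made a graph by symmetrising it and ignoring the diagonal, so the search
-- ranges over all matrices without a validity condition.
matrixGraph : ∀ {k} → Matrix k → Graph
matrixGraph {k} m = record
  { Vertex   = Fin k
  ; order    = k
  ; vertices = ↔-id (Fin k)
  ; _∼_      = λ i j → i ≢ j × (entry m i j ≡ true ⊎ entry m j i ≡ true)
  ; _∼?_     = λ i j → ¬? (i Fin.≟ j) ×-dec ((entry m i j Bool.≟ true) ⊎-dec (entry m j i Bool.≟ true))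
  ; ∼-sym    = λ { (i≢j , inj₁ p) → i≢j ∘ sym , inj₂ p ; (i≢j , inj₂ p) → i≢j ∘ sym , inj₁ p }
  ; ∼-irrefl = λ { refl (i≢i , _) → i≢i refl }
  }

AllPairs-lookup : ∀ {A : Set} {R : A → A → Set} {xs} → AllPairs R xs → ∀ {i j} → i Fin.< j →
                  R (List.lookup xs i) (List.lookup xs j)
AllPairs-lookup (rx ∷ _)  {Fin.zero}  {Fin.suc j} _         = All.lookup rx (∈-lookup j)
AllPairs-lookup (_ ∷ rxs) {Fin.suc i} {Fin.suc j} (s≤s i<j) = AllPairs-lookup rxs i<j

to-injective : ∀ {A B : Set} (A↔B : A ↔ B) {x y} → Inverse.to A↔B x ≡ Inverse.to A↔B y → x ≡ y
to-injective A↔B {x} {y} eq = trans (sym (Inverse.strictlyInverseʳ A↔B x))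
  (trans (cong (Inverse.from A↔B) eq) (Inverse.strictlyInverseʳ A↔B y))

∈-edges : ∀ (G : Graph) {i j} → i Fin.< j → Graph._∼_ G (Graph.vertex G i) (Graph.vertex G j) → (i , j) ∈ Graph.edges G
∈-edges G {i} {j} i<j adj = ∈-filter⁺ _ (∈-cartesianProduct⁺ (∈-allFin i) (∈-allFin j)) (i<j , adj)

module Arrow (F : Graph) where

  private module F = Graph F

  label : F.Vertex → Fin F.order
  label = Inverse.to F.vertices

  relabel : ∀ {u v} → u F.∼ v → F.vertex (label u) F.∼ F.vertex (label v)
  relabel = subst₂ F._∼_ (sym (Inverse.strictlyInverseʳ F.vertices _)) (sym (Inverse.strictlyInverseʳ F.vertices _))

  module _ {k : ℕ} (m : Matrix k) where

    private module M = Graph (matrixGraph m)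

    -- Reading a colour matrix through ∧ makes it symmetric.
    paint : Matrix k → Fin k → Fin k → Bool
    paint c i j = entry c i j ∧ entry c j i

    -- A copy is a vector and a colouring a matrix, so that all quantifiers are finite. Colours of
    -- non-edges do no harm: only images of edges are inspected.
    MonoCopy : Matrix k → Vec (Fin k) F.order → Set
    MonoCopy c f =
      (∀ x y → Vec.lookup f x ≡ Vec.lookup f y → x ≡ y) ×
      (∀ x y → F.vertex x F.∼ F.vertex y → Vec.lookup f x M.∼ Vec.lookup f y) ×
      (∃[ b ] (∀ x y → F.vertex x F.∼ F.vertex y → paint c (Vec.lookup f x) (Vec.lookup f y) ≡ b))

    MonoCopy? : ∀ c f → Dec (MonoCopy c f)
    MonoCopy? c f =
      (Fin.all? λ x → Fin.all? λ y → (Vec.lookup f x Fin.≟ Vec.lookup f y) →-dec (x Fin.≟ y)) ×-dec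
      (Fin.all? λ x → Fin.all? λ y → (F.vertex x F.∼? F.vertex y) →-dec (Vec.lookup f x M.∼? Vec.lookup f y)) ×-dec
      (search-Bool λ b → Fin.all? λ x → Fin.all? λ y →
        (F.vertex x F.∼? F.vertex y) →-dec (paint c (Vec.lookup f x) (Vec.lookup f y) Bool.≟ b))

    always⇒arrow : (∀ c → ∃ (MonoCopy c)) → matrixGraph m ⟶ F
    always⇒arrow always χ with always (matrix (Total.colourOf χ))
    ... | f , f-inj , f-edge , b , f-mono =
      record
        { embed     = λ u → Vec.lookup f (label u)
        ; injective = λ eq → to-injective F.vertices (f-inj _ _ eq)
        ; edge      = λ p → f-edge _ _ (relabel p)
        } , b , λ {u} {v} p → trans (Total.colourOf-∼ χ _ _ (f-edge _ _ (relabel p)))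
          (trans (sym (painted (Vec.lookup f (label u)) (Vec.lookup f (label v)))) (f-mono _ _ (relabel p)))
      where
      painted : ∀ i j → paint (matrix (Total.colourOf χ)) i j ≡ Total.colourOf χ i j
      painted i j = trans (cong₂ _∧_ (entry-matrix _ i j) (trans (entry-matrix _ j i) (Total.colourOf-sym χ j i)))
        (Bool.∧-idem _)

    arrow⇒always : matrixGraph m ⟶ F → ∀ c → ∃ (MonoCopy c)
    arrow⇒always arrow c with arrow (record
      { colour     = λ {i} {j} _ → paint c i j
      ; colour-sym = λ {i} {j} _ _ → Bool.∧-comm (entry c i j) (entry c j i)
      })
    ... | φ , b , mono = Vec.tabulate g ,
      (λ x y eq → from-injective F.vertices (Copy.injective φ (trans (sym (lookup-g x)) (trans eq (lookup-g y))))) ,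
      (λ x y p → subst₂ M._∼_ (sym (lookup-g x)) (sym (lookup-g y)) (Copy.edge φ p)) ,
      b , (λ x y p → trans (cong₂ (paint c) (lookup-g x) (lookup-g y)) (mono p))
      where
      g : Fin F.order → Fin k
      g x = Copy.embed φ (F.vertex x)
      lookup-g : ∀ x → Vec.lookup (Vec.tabulate g) x ≡ g x
      lookup-g = Vec.lookup∘tabulate g

    arrow? : Dec (matrixGraph m ⟶ F)
    arrow? = map′ always⇒arrow arrow⇒always
      (search-all (search-Matrix k) λ c → search-Vec Fin.any? F.order (MonoCopy? c))

  -- Discarding isolated vertices bounds the order of the graphs to be searched.
  module Core (neighbour : ∀ u → ∃[ v ] u F.∼ v) (G : Graph) (G⟶F : G ⟶ F) where

    private module G = Graph G

    Joined : Fin G.order → Set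
    Joined i = ∃[ j ] G.vertex i G.∼ G.vertex j

    joined? : ∀ i → Dec (Joined i)
    joined? i = Fin.any? λ j → G.vertex i G.∼? G.vertex j

    core : List (Fin G.order)
    core = filter joined? (allFin G.order)

    k : ℕ
    k = length core

    coreVertex : Fin k → G.Vertex
    coreVertex i = G.vertex (List.lookup core i)

    increasing : AllPairs Fin._<_ core
    increasing = AllPairs.filter⁺ joined? (AllPairs.tabulate⁺-< {f = id} id)

    Unique-core : Unique core
    Unique-core = Unique.filter⁺ joined? (Unique.allFin⁺ G.order)

    k≤2e : k ≤ 2 * G.e
    k≤2e = ≤-trans (Unique-⊆⇒length≤ Unique-core covered) (≤-reflexive (trans
      (List.length-++ (map proj₁ G.edges))
      (cong₂ _+_ (List.length-map proj₁ G.edges) (trans (List.length-map proj₂ G.edges) (sym (+-identityʳ _))))))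
      where
      covered : core ⊆ map proj₁ G.edges ++ map proj₂ G.edges
      covered {i} i∈ with proj₂ (∈-filter⁻ joined? {xs = allFin G.order} i∈)
      ... | j , adj with <-cmp (toℕ i) (toℕ j)
      ...   | tri< i<j _ _ = ∈-++⁺ˡ (∈-map⁺ proj₁ (∈-edges G i<j adj))
      ...   | tri≈ _ i≡j _ = contradiction adj (G.∼-irrefl (cong G.vertex (Fin.toℕ-injective i≡j)))
      ...   | tri> _ _ j<i = ∈-++⁺ʳ (map proj₁ G.edges) (∈-map⁺ proj₂ (∈-edges G j<i (G.∼-sym adj)))

    m : Matrix k
    m = matrix λ i j → does (coreVertex i G.∼? coreVertex j)

    private module M = Graph (matrixGraph m)

    does⁻ : ∀ {P : Set} (P? : Dec P) → does P? ≡ true → P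
    does⁻ (yes p) _ = p

    does⁺ : ∀ {P : Set} (P? : Dec P) → P → does P? ≡ true
    does⁺ (yes _) _ = refl
    does⁺ (no ¬p) p = contradiction p ¬p

    adj⁻ : ∀ {i j} → i M.∼ j → coreVertex i G.∼ coreVertex j
    adj⁻ {i} {j} (_ , inj₁ eq) = does⁻ (coreVertex i G.∼? coreVertex j) (trans (sym (entry-matrix _ i j)) eq)
    adj⁻ {i} {j} (_ , inj₂ eq) = G.∼-sym (does⁻ (coreVertex j G.∼? coreVertex i) (trans (sym (entry-matrix _ j i)) eq))

    adj⁺ : ∀ {i j} → coreVertex i G.∼ coreVertex j → i M.∼ j
    adj⁺ {i} {j} adj = (λ i≡j → G.∼-irrefl (cong coreVertex i≡j) adj) ,
      inj₁ (trans (entry-matrix _ i j) (does⁺ (coreVertex i G.∼? coreVertex j) adj))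

    lookup-injective : ∀ {i j} → List.lookup core i ≡ List.lookup core j → i ≡ j
    lookup-injective = Unique-map-lookup id (subst Unique (sym (List.map-id core)) Unique-core) _ _

    coreVertex-injective : ∀ {i j} → coreVertex i ≡ coreVertex j → i ≡ j
    coreVertex-injective eq = lookup-injective (from-injective G.vertices eq)

    e-core≤ : M.e ≤ G.e
    e-core≤ = ≤-trans (≤-reflexive (sym (List.length-map endpoints M.edges)))
      (Unique-⊆⇒length≤ (Unique.map⁺ endpoints-injective (Unique-edges (matrixGraph m))) covered)
      where
      endpoints : Fin k × Fin k → Fin G.order × Fin G.order
      endpoints (i , j) = List.lookup core i , List.lookup core j
      endpoints-injective : ∀ {x y} → endpoints x ≡ endpoints y → x ≡ y
      endpoints-injective eq = cong₂ _,_ (lookup-injective (cong proj₁ eq)) (lookup-injective (cong proj₂ eq))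
      covered : map endpoints M.edges ⊆ G.edges
      covered z∈ with ∈-map⁻ endpoints z∈
      ... | (i , j) , ij∈ , refl with ∈-edges⁻ (matrixGraph m) ij∈
      ...   | i<j , adj = ∈-edges G (AllPairs-lookup increasing i<j) (adj⁻ adj)

    abstract
      -- The edge only witnesses that `u` is not isolated; any other edge at `u` gives the same
      -- position, by `coreVertex-injective`.
      position : ∀ u → (∃[ v ] u G.∼ v) → ∃[ i ] coreVertex i ≡ u
      position u (v , u∼v) = Any.index u∈ , trans (cong G.vertex (sym (Any.lookup-index u∈))) (Inverse.strictlyInverseʳ G.vertices u)
        where
        u∈ : Inverse.to G.vertices u ∈ core
        u∈ = ∈-filter⁺ joined? (∈-allFin _) (Inverse.to G.vertices v ,
          subst₂ G._∼_ (sym (Inverse.strictlyInverseʳ G.vertices u)) (sym (Inverse.strictlyInverseʳ G.vertices v)) u∼v)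

    -- Both endpoints of every edge of `G` lie in the core, so a colouring of the core colours all
    -- of `G`. The copy found in `G` lies in the core because each vertex of `F` has a neighbour.
    core⟶F : matrixGraph m ⟶ F
    core⟶F χ′ = φ′ , proj₁ (proj₂ copy) , λ {x} {y} p → trans (Total.colourOf-∼ χ′ (at x) (at y) (edge′ p))
        (trans (cong₂ (Total.colourOf χ′) (same (place x) (position (embed x) (embed y , edge p)))
            (same (place y) (position (embed y) (embed x , G.∼-sym (edge p)))))
          (proj₂ (proj₂ copy) p))
      where
      same : ∀ {u} (x y : ∃[ i ] coreVertex i ≡ u) → proj₁ x ≡ proj₁ y
      same (i , eq) (j , eq′) = coreVertex-injective (trans eq (sym eq′))

      χ : Colouring G
      χ = record
        { colour     = λ {u} {v} p → Total.colourOf χ′ (proj₁ (position u (v , p))) (proj₁ (position v (u , G.∼-sym p)))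
        ; colour-sym = λ {u} {v} p q → trans
            (cong₂ (Total.colourOf χ′) (same (position u (v , p)) (position u (v , G.∼-sym q)))
              (same (position v (u , G.∼-sym p)) (position v (u , q))))
            (Total.colourOf-sym χ′ (proj₁ (position u (v , G.∼-sym q))) (proj₁ (position v (u , q))))
        }

      copy : Σ[ φ ∈ Copy F G ] Monochromatic χ φ
      copy = G⟶F χ

      open Copy (proj₁ copy)

      place : ∀ x → ∃[ i ] coreVertex i ≡ embed x
      place x = position (embed x) (embed (proj₁ (neighbour x)) , edge (proj₂ (neighbour x)))
      at : F.Vertex → Fin k
      at x = proj₁ (place x)
      edge′ : ∀ {x y} → x F.∼ y → at x M.∼ at y
      edge′ {x} {y} p = adj⁺ (subst₂ G._∼_ (sym (proj₂ (place x))) (sym (proj₂ (place y))) (edge p))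
      φ′ : Copy F (matrixGraph m)
      φ′ = record
        { embed     = at
        ; injective = λ {x} {y} eq → injective (trans (sym (proj₂ (place x))) (trans (cong coreVertex eq) (proj₂ (place y))))
        ; edge      = edge′
        }

  module Minimum (neighbour : ∀ u → ∃[ v ] u F.∼ v) (bound : ℕ) where

    -- With `≤ l` in place of equality, the core of `G` is a witness by `e-core≤` alone; `attained`
    -- regains equality from minimality.
    Small : ℕ → Set
    Small l = Σ[ o ∈ Fin (suc (2 * bound)) ] Σ[ m ∈ Matrix (toℕ o) ] (matrixGraph m ⟶ F) × Graph.e (matrixGraph m) ≤ l

    Small? : ∀ l → Dec (Small l)
    Small? l = Fin.any? λ o → search-Matrix (toℕ o) λ m → arrow? m ×-dec (Graph.e (matrixGraph m) ≤? l)

    small : ∀ G → G ⟶ F → Graph.e G ≤ bound → Small (Graph.e G)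
    small G arrow e≤ = fromℕ< k< ,
      subst (λ o → Σ[ m ∈ Matrix o ] (matrixGraph m ⟶ F) × Graph.e (matrixGraph m) ≤ Graph.e G)
        (sym (Fin.toℕ-fromℕ< k<)) (C.m , C.core⟶F , C.e-core≤)
      where
      module C = Core neighbour G arrow
      k< : C.k < suc (2 * bound)
      k< = s≤s (≤-trans C.k≤2e (*-monoʳ-≤ 2 e≤))

    attained : ∀ r → Small r → r ≤ bound → (∀ j → Small j → r ≤ j) → IsSizeRamseyNumber F r
    attained r (o , m , arrow , e≤r) r≤ minimal =
      (matrixGraph m , arrow , ≤-antisym e≤r (minimal _ (o , m , arrow , ≤-refl))) , lower
      where
      lower : ∀ G → G ⟶ F → r ≤ Graph.e G
      lower G arrow′ with ≤-total (Graph.e G) bound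
      ... | inj₁ e≤ = minimal _ (small G arrow′ e≤)
      ... | inj₂ ge = ≤-trans r≤ ge

  size-ramsey-exists : (∀ u → ∃[ v ] u F.∼ v) → (G : Graph) → G ⟶ F →
                       ∃[ r ] IsSizeRamseyNumber F r × r ≤ Graph.e G
  size-ramsey-exists neighbour G G⟶F = conclude (least Small? (Graph.e G) (small G G⟶F ≤-refl))
    where
    open Minimum neighbour (Graph.e G)
    conclude : (∃[ r ] Small r × r ≤ Graph.e G × (∀ j → Small j → r ≤ j)) → ∃[ r ] IsSizeRamseyNumber F r × r ≤ Graph.e G
    conclude (r , small-r , r≤ , minimal) = r , attained r small-r r≤ minimal , r≤

-- Choice of the parameters and the exponent.

-- For the least m with x ≤ m^k, either m = 1, or (m - 1)^k < x and m ≤ 2 (m - 1).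
root : ∀ k x → 1 ≤ k → 1 ≤ x → ∃[ m ] 1 ≤ m × x ≤ m ^ k × m ^ k ≤ 2 ^ k * x
root (suc k) x _ 1≤x with least (λ m → x ≤? m ^ suc k) x (≤-trans (≤-reflexive (sym (*-identityʳ x)))
                           (*-monoʳ-≤ x (m^n>0 x {{>-nonZero 1≤x}} k)))
... | zero , x≤0 , _ = contradiction (≤-trans 1≤x x≤0) λ ()
... | suc zero , x≤1 , _ = 1 , ≤-refl , x≤1 ,
        ≤-trans (≤-reflexive (^-zeroˡ (suc k))) (*-mono-≤ (m^n>0 2 (suc k)) 1≤x)
... | suc (suc m) , x≤ , _ , minimal = suc (suc m) , s≤s z≤n , x≤ , (begin
  suc (suc m) ^ suc k            ≤⟨ ^-monoˡ-≤ (suc k) (s≤s (≤-trans (s≤s (m≤m+n m 0)) (m≤n+m (suc (m + 0)) m))) ⟩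
  (2 * suc m) ^ suc k            ≡⟨ ^-distribʳ-* (suc k) 2 (suc m) ⟩
  2 ^ suc k * suc m ^ suc k      ≤⟨ *-monoʳ-≤ (2 ^ suc k) (<⇒≤ (≰⇒> λ x≤′ → 1+n≰n (minimal (suc m) x≤′))) ⟩
  2 ^ suc k * x                  ∎)
  where open ≤-Reasoning

square-cancel-≤ : ∀ a b → a * a ≤ b * b → a ≤ b
square-cancel-≤ a b le = ≮⇒≥ λ b<a → <⇒≱ (*-mono-< b<a b<a) le

-- The single vertex of the 1 × 1 grid is isolated, so sides start at 2.
grid-neighbour : ∀ n (u : Fin (suc (suc n)) × Fin (suc (suc n))) →
                 ∃[ v ] Graph._∼_ (grid (suc (suc n)) (suc (suc n))) u v
grid-neighbour n (a , Fin.zero)  = (a , Fin.suc Fin.zero) , inj₁ (refl , refl)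
grid-neighbour n (a , Fin.suc b) = (a , Fin.inject₁ b) ,
  inj₁ (refl , trans (cong ∣ suc (toℕ b) -_∣ (Fin.toℕ-inject₁ b)) (distance (toℕ b)))
  where
  distance : ∀ k → ∣ suc k - k ∣ ≡ 1
  distance zero    = refl
  distance (suc k) = distance k

-- With m ≈ n^(1/4q) the clusters of the host have c·n·m vertices.
module Bounds (t : ℕ) (gap : 48 ^ t * 4 ^ 7 < 49 ^ t) (d : ℕ) (32≤d : 32 ≤ d) (q : ℕ) (1≤q : 1 ≤ q) where

  -- The cluster size is c n m, so the 1 in r = 4q + 1 cancels its factor m and the condition 2s ≤
  -- m^r becomes 2cn ≤ m^(4q). The edge count is at most K n^3 m^2.
  r c K threshold : ℕ
  r = suc (4 * q)
  c = 2 * d * d ^ r * d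
  K = 4 * t * (c * c)
  threshold = K ^ q * K ^ q * (2 ^ (4 * q) * (2 * c))

  1≤c : 1 ≤ c
  1≤c = *-mono-≤ (*-mono-≤ (*-mono-≤ {1} {2} (s≤s z≤n) 1≤d) (m^n>0 d {{>-nonZero 1≤d}} r)) 1≤d
    where
    1≤d : 1 ≤ d
    1≤d = ≤-trans (s≤s z≤n) 32≤d

  Host : ℕ → ℕ → Set₁
  Host n m = Σ[ G ∈ Graph ] (G ⟶ grid (suc n) (suc n)) × Graph.e G ≤ K * (suc n ^ 3 * (m * m))

  Expander : ℕ → ℕ → Set
  Expander L N = ∃[ hs ] length hs ≤ t * L ×
    (∀ (xs ys : List (Fin N)) → Unique xs → Unique ys → L ≤ length xs → L ≤ length ys →
     ∃₂ λ x y → x ∈ xs × y ∈ ys × (x , y) ∈ hs)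

  edge-bound : ∀ n m l s → s ≡ c * (suc n * m) → l ≤ t * suc (n + n) →
               2 * l * (s * s) ≤ K * (suc n ^ 3 * (m * m))
  edge-bound n m l s s≡ l≤ = begin
    2 * l * (s * s)                               ≤⟨ *-monoˡ-≤ (s * s) (*-monoʳ-≤ 2 l≤) ⟩
    2 * (t * suc (n + n)) * (s * s)               ≤⟨ *-monoˡ-≤ (s * s) (*-monoʳ-≤ 2 (*-monoʳ-≤ t (≤-trans (n≤1+n _) (≤-reflexive (double n))))) ⟩
    2 * (t * (2 * suc n)) * (s * s)               ≡⟨ cong (λ z → 2 * (t * (2 * suc n)) * (z * z)) s≡ ⟩
    2 * (t * (2 * suc n)) * (c * (suc n * m) * (c * (suc n * m))) ≡⟨ collect t (suc n) c m ⟩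
    K * (suc n ^ 3 * (m * m))                     ∎
    where
    open ≤-Reasoning
    double : ∀ n → suc (suc (n + n)) ≡ 2 * suc n
    double = solve-∀
    collect : ∀ t n c m → 2 * (t * (2 * n)) * (c * (n * m) * (c * (n * m))) ≡ 4 * t * (c * c) * (n * (n * (n * 1)) * (m * m))
    collect = solve-∀

  -- The derived sizes enter as variables with equations and stay symbolic in `Ramsey`.
  host-from : ∀ n m u₀ s L N → 1 ≤ m → u₀ ≡ d * (suc n * m) → s ≡ 2 * d * d ^ r * u₀ →
              L ≡ suc (n + n) → N ≡ 7 * L → 2 * c * suc n ≤ m ^ (4 * q) → Expander L N → Host n m
  host-from n m u₀ s L N 1≤m u₀≡ s≡ L≡ N≡ enough (hs , |hs|≤ , joins) =
    R.blowup , R.arrows , ≤-trans (R.e-blowup≤ hs proj₂)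
      (edge-bound n m (length hs) s s≡c (≤-trans |hs|≤ (≤-reflexive (cong (t *_) L≡))))
    where
    open ≤-Reasoning
    s≡c : s ≡ c * (suc n * m)
    s≡c = trans s≡ (trans (cong (2 * d * d ^ r *_) u₀≡) (sym (*-assoc (2 * d * d ^ r) d (suc n * m))))

    large : 2 * s ≤ m ^ r
    large = begin
      2 * s                       ≡⟨ cong (2 *_) s≡c ⟩
      2 * (c * (suc n * m))       ≡⟨ rearrange c (suc n) m ⟩
      m * (2 * c * suc n)         ≤⟨ *-monoʳ-≤ m enough ⟩
      m ^ r                       ∎
      where
      rearrange : ∀ c n m → 2 * (c * (n * m)) ≡ m * (2 * c * n)
      rearrange = solve-∀

    module R = Ramsey n d r m u₀ s L N 32≤d 1≤m u₀≡ s≡ large L≡ N≡ hs joins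

  host : ∀ n m → 1 ≤ m → 2 * c * suc n ≤ m ^ (4 * q) → Host n m
  host n m 1≤m enough = host-from n m _ _ _ _ 1≤m refl refl refl refl enough (expander t gap (suc (n + n)) (s≤s z≤n))

  -- As m^(4q) is at most a constant times n, m^(2q) is of order √n, and the other √n absorbs the
  -- constants. Comparing squares avoids the root.
  absorb : ∀ n m → threshold ≤ n → m ^ (4 * q) ≤ 2 ^ (4 * q) * (2 * c * n) → (K * (m * m)) ^ q ≤ n
  absorb n m threshold≤n m≤ = square-cancel-≤ _ _ (begin
    (K * (m * m)) ^ q * (K * (m * m)) ^ q     ≡⟨ cong (λ z → z * z) (^-distribʳ-* q K (m * m)) ⟩
    K ^ q * (m * m) ^ q * (K ^ q * (m * m) ^ q) ≡⟨ regroup (K ^ q) ((m * m) ^ q) ⟩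
    K ^ q * K ^ q * ((m * m) ^ q * (m * m) ^ q) ≡⟨ cong (K ^ q * K ^ q *_) powers ⟩
    K ^ q * K ^ q * m ^ (4 * q)               ≤⟨ *-monoʳ-≤ (K ^ q * K ^ q) m≤ ⟩
    K ^ q * K ^ q * (2 ^ (4 * q) * (2 * c * n)) ≡⟨ collect (K ^ q * K ^ q) (2 ^ (4 * q)) (2 * c) n ⟩
    threshold * n                             ≤⟨ *-monoˡ-≤ n threshold≤n ⟩
    n * n                                     ∎)
    where
    open ≤-Reasoning
    regroup : ∀ a b → a * b * (a * b) ≡ a * a * (b * b)
    regroup = solve-∀
    collect : ∀ a b c n → a * (b * (c * n)) ≡ a * (b * c) * n
    collect = solve-∀
    fourth : ∀ m → m * m * (m * m) ≡ m * (m * (m * (m * 1)))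
    fourth = solve-∀
    powers : (m * m) ^ q * (m * m) ^ q ≡ m ^ (4 * q)
    powers = trans (sym (^-distribʳ-* q (m * m) (m * m))) (trans (cong (_^ q) (fourth m)) (^-*-assoc m 4 q))

  -- Of the surplus (p + 1)/q in the exponent only 1/q is spent, on the factor (K m^2)^q ≤ n.
  power-bound : ∀ p n m k → 1 ≤ n → threshold ≤ n → m ^ (4 * q) ≤ 2 ^ (4 * q) * (2 * c * n) →
                k ≤ K * (n ^ 3 * (m * m)) → k ^ q ≤ n ^ (3 * q + suc p)
  power-bound p n m k 1≤n threshold≤ m≤ k≤ = begin
    k ^ q                               ≤⟨ ^-monoˡ-≤ q k≤ ⟩
    (K * (n ^ 3 * (m * m))) ^ q         ≡⟨ cong (_^ q) (exchange K (n ^ 3) (m * m)) ⟩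
    (n ^ 3 * (K * (m * m))) ^ q         ≡⟨ ^-distribʳ-* q (n ^ 3) (K * (m * m)) ⟩
    (n ^ 3) ^ q * (K * (m * m)) ^ q     ≤⟨ *-mono-≤ (≤-reflexive (^-*-assoc n 3 q)) (absorb n m threshold≤ m≤) ⟩
    n ^ (3 * q) * n                     ≤⟨ *-monoʳ-≤ (n ^ (3 * q)) (≤-trans (≤-reflexive (sym (*-identityʳ n))) (*-monoʳ-≤ n (m^n>0 n {{>-nonZero 1≤n}} p))) ⟩
    n ^ (3 * q) * n ^ suc p             ≡⟨ ^-distribˡ-+-* n (3 * q) (suc p) ⟨
    n ^ (3 * q + suc p)                 ∎
    where
    open ≤-Reasoning
    exchange : ∀ a b c → a * (b * c) ≡ b * (a * c)
    exchange = solve-∀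

  size-ramsey≤ : ∀ p n → 2 + threshold ≤ n →
                 ∃[ k ] IsSizeRamseyNumber (grid n n) k × k ^ q ≤ n ^ (3 * q + suc p)
  size-ramsey≤ p (suc (suc n)) (s≤s (s≤s threshold≤)) = from-root (root (4 * q) (2 * c * suc (suc n))
      (*-mono-≤ {1} {4} (s≤s z≤n) 1≤q) (*-mono-≤ (*-mono-≤ {1} {2} (s≤s z≤n) 1≤c) (s≤s z≤n)))
    where
    Goal : Set₁
    Goal = ∃[ k ] IsSizeRamseyNumber (grid (suc (suc n)) (suc (suc n))) k × k ^ q ≤ suc (suc n) ^ (3 * q + suc p)

    from-host : ∀ m → m ^ (4 * q) ≤ 2 ^ (4 * q) * (2 * c * suc (suc n)) → Host (suc n) m → Goal
    from-host m m≤ (G , G⟶grid , e≤) =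
      let (k , ramsey , k≤) = Arrow.size-ramsey-exists (grid (suc (suc n)) (suc (suc n))) (grid-neighbour n) G G⟶grid
      in k , ramsey , power-bound p (suc (suc n)) m k (s≤s z≤n) (≤-trans threshold≤ (m≤n+m n 2)) m≤ (≤-trans k≤ e≤)

    from-root : (∃[ m ] 1 ≤ m × 2 * c * suc (suc n) ≤ m ^ (4 * q) × m ^ (4 * q) ≤ 2 ^ (4 * q) * (2 * c * suc (suc n))) → Goal
    from-root (m , 1≤m , enough , m≤) = from-host m m≤ (host (suc n) m 1≤m enough)

^ℚ-intro : ∀ k n p q → k ^ suc q ≤ n ^ (3 * suc q + suc p) →
           k ≤ n ^ℚ ((ℤ.+ 3) / 1 ℚᵘ.+ mkℚᵘ (ℤ.+ suc p) q)
-- Unnormalised addition yields the numerator 3(q+1) + (p+1)·1 over 1·(q+1), which computes to suc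
-- (q + 0).
^ℚ-intro k n p q = subst₂ (λ a b → k ^ suc a ≤ n ^ b) (sym (+-identityʳ q)) (sym (cong ℤ.∣_∣ numerator))
  where
  numerator : (ℤ.+ 3) ℤ.* (ℤ.+ suc q) ℤ.+ (ℤ.+ suc p) ℤ.* (ℤ.+ 1) ≡ ℤ.+ (3 * suc q + suc p)
  numerator = cong₂ ℤ._+_ (sym (ℤ.pos-* 3 (suc q))) (ℤ.*-identityʳ (ℤ.+ suc p))

-- While `t` and `d` are variables, quantities such as `threshold` stay symbolic; numbers are put in
-- only at the end.
size-ramsey-grid : ∀ t → 48 ^ t * 4 ^ 7 < 49 ^ t → ∀ d → 32 ≤ d → (ε : ℚᵘ) → 0ℚᵘ ℚᵘ.< ε →
  ∃[ n₀ ] ((n : ℕ) → n ≥ n₀ →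
    ∃[ r ] (IsSizeRamseyNumber (grid n n) r × r ≤ n ^ℚ ((ℤ.+ 3) / 1 ℚᵘ.+ ε)))
size-ramsey-grid t gap d 32≤d (mkℚᵘ (ℤ.+ suc p) q) _ = 2 + threshold , λ n n≥ →
  let (k , ramsey , k≤) = size-ramsey≤ p n n≥ in k , ramsey , ^ℚ-intro k n p q k≤
  where open Bounds t gap d 32≤d (suc q) (s≤s z≤n)
size-ramsey-grid _ _ _ _ (mkℚᵘ (ℤ.+ zero) q) (ℚᵘ.*<* (ℤ.+<+ ()))
size-ramsey-grid _ _ _ _ (mkℚᵘ -[1+ p ] q) (ℚᵘ.*<* ())

open import Data.Integer.Base using (+_)

corollary1p2 : (ε : ℚᵘ) → 0ℚᵘ ℚᵘ.< ε →
    ∃[ n₀ ] ((n : ℕ) → n ≥ n₀ →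
    ∃[ r ] (IsSizeRamseyNumber (grid n n) r × r ≤ n ^ℚ (+ 3 / 1 ℚᵘ.+ ε)))
corollary1p2 = size-ramsey-grid 480 480-steps-suffice 32 ≤-refl
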